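{- Let $1\le i<j\le m$. For all sufficiently large positive integers $q$, the number $|M((\mathcal{B}_m^{\{x_i+x_j=1\}})_q)|$ of points $(x_1,\dots,x_m)\in\mathbb{Z}_q^m$ with $x_i+x_j=1$ that lie on no hyperplane $H'_q$ with $H'\in\mathcal{B}_m\setminus\{\{x_i+x_j=1\}\}$ equals $$\begin{cases}(q-2m)^{i-1}(q-2m+1)^{j-i}(q-2m+2)^{m-j} & \text{if } q \text{ is odd},\\ (q-2m)^{i-1}(q-2m+1)^{j-i-1}\big((q-2m+2)^{m-j+1}-(q-2m+1)^{m-j}\big) & \text{if } q \text{ is even}.\end{cases}$$
   Context: For $m\ge1$, the Shi arrangement of type B is the set of affine hyperplanes in $\mathbb{R}^m$ $$\mathcal{B}_m=\{\{x_s=0\},\{x_s=1\}\mid s\in[m]\}\cup\{\{x_s\pm x_t=0\},\{x_s\pm x_t=1\}\mid 1\le s<t\le m\},$$ where $[m]=\{1,\dots,m\}$. For a positive integer $q$ and a hyperplane $H=\{a_1x_1+\dots+a_mx_m=b\}$ with integer coefficients, $H_q=\{x\in\mathbb{Z}_q^m : [a_1]_qx_1+\dots+[a_m]_qx_m=[b]_q\}$ is its reduction modulo $q$, with $\mathbb{Z}_q=\mathbb{Z}/q\mathbb{Z}$. For $H\in\mathcal{B}_m$, the restriction is $\mathcal{B}_m^H=\{H\cap H' : H'\in\mathcal{B}_m\setminus\{H\},\ H\cap H'\neq\emptyset\}$, and $|M((\mathcal{B}_m^H)_q)|$ denotes the number of points of $H_q$ not lying on any $H'_q$ with $H'\in\mathcal{B}_m\setminus\{H\}$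 (the characteristic quasi-polynomial of the restriction). -}

module Defs where

open import Data.Nat as ℕ using (ℕ; zero; suc)
open import Data.Integer as ℤ using (ℤ; +_; _-_; _*_; _+_; -_)
open import Data.Integer.Divisibility using (_∣_)
open import Data.Nat.Divisibility using (_∣?_)
open import Data.Fin using (Fin; toℕ; _<_)
open import Data.Fin.Properties using (_<?_)
open import Data.Vec as Vec using (Vec; []; _∷_; tabulate; zipWith)
open import Data.Vec.Properties using (≡-dec)
open import Data.List as List using (List; []; _∷_; _++_; concatMap; allFin; filter; length; map)
open import Data.List.Relation.Unary.All using (All)
open import Data.List.Relation.Unary.All.Properties using ()
import Data.List.Relation.Unary.All as All
open import Data.Product using (_×_; _,_)
open import Relation.Nullary using (Dec; ¬_; yes; no)
open import Relation.Nullary.Decidable using (_×-dec_; ¬?)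
open import Relation.Binary.PropositionalEquality using (_≡_; _≢_)
open import Data.Integer.Properties as ℤP using ()

record Hyperplane (m : ℕ) : Set where
  constructor hyp
  field
    coeffs : Vec ℤ m
    rhs    : ℤ
open Hyperplane public

_≟H_ : ∀ {m} (H H′ : Hyperplane m) → Dec (H ≡ H′)
hyp a b ≟H hyp a′ b′ with ≡-dec ℤ._≟_ a a′ | b ℤ.≟ b′
... | yes Relation.Binary.PropositionalEquality.refl | yes Relation.Binary.PropositionalEquality.refl = yes Relation.Binary.PropositionalEquality.refl
... | no ne | _ = no λ { Relation.Binary.PropositionalEquality.refl → ne Relation.Binary.PropositionalEquality.refl }
... | yes _ | no ne = no λ { Relation.Binary.PropositionalEquality.refl → ne Relation.Binary.PropositionalEquality.refl }

e : ∀ {m} → Fin m → Vec ℤ m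
e s = tabulate λ k → if⌊ k Data.Fin.≟ s ⌋
  where
  if⌊_⌋ : ∀ {P : Set} → Dec P → ℤ
  if⌊ yes _ ⌋ = + 1
  if⌊ no _ ⌋  = + 0

hCoord : ∀ {m} → Fin m → ℤ → Hyperplane m
hCoord s b = hyp (e s) b

hPlus : ∀ {m} → Fin m → Fin m → ℤ → Hyperplane m
hPlus s t b = hyp (zipWith _+_ (e s) (e t)) b

hMinus : ∀ {m} → Fin m → Fin m → ℤ → Hyperplane m
hMinus s t b = hyp (zipWith _-_ (e s) (e t)) b

pairs : (m : ℕ) → List (Fin m × Fin m)
pairs m = filter (λ p → Data.Product.proj₁ p <? Data.Product.proj₂ p)
            (concatMap (λ s → map (s ,_) (allFin m)) (allFin m))

shiB : (m : ℕ) → List (Hyperplane m)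
shiB m =
  concatMap (λ s → hCoord s (+ 0) ∷ hCoord s (+ 1) ∷ []) (allFin m)
  ++ concatMap (λ { (s , t) → hPlus s t (+ 0) ∷ hPlus s t (+ 1)
                              ∷ hMinus s t (+ 0) ∷ hMinus s t (+ 1) ∷ [] })
               (pairs m)

shiBWithout : (m : ℕ) → Hyperplane m → List (Hyperplane m)
shiBWithout m H = filter (λ H′ → ¬? (H′ ≟H H)) (shiB m)

-- all points of ℤ_q^m, with ℤ_q represented by Fin q
allPoints : (q m : ℕ) → List (Vec (Fin q) m)
allPoints q zero = [] ∷ []
allPoints q (suc m) = concatMap (λ x → map (x ∷_) (allPoints q m)) (allFin q)

lhs : ∀ {q m} → Vec ℤ m → Vec (Fin q) m → ℤ
lhs [] [] = + 0
lhs (a ∷ as) (x ∷ xs) = a * + toℕ x + lhs as xs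

-- x ∈ H_q : [a₁]x₁+…+[aₘ]xₘ = [b] in ℤ_q  (i.e. q divides a·x − b)
_∈H_ : ∀ {q m} → Vec (Fin q) m → Hyperplane m → Set
_∈H_ {q} x H = + q ∣ (lhs (coeffs H) x - rhs H)

_∈H?_ : ∀ {q m} (x : Vec (Fin q) m) (H : Hyperplane m) → Dec (x ∈H H)
_∈H?_ {q} x H = q ∣? ℤ.∣ lhs (coeffs H) x - rhs H ∣

charQP : (m q : ℕ) → Hyperplane m → ℕ
charQP m q H = length (filter (λ x → (x ∈H? H) ×-dec
                                   All.all? (λ H′ → ¬? (x ∈H? H′)) (shiBWithout m H))
                              (allPoints q m))

-- closed formula of Theorem 8.1 (i, j are 0-based: paper's i = toℕ i + 1)
oddFormula evenFormula : (m q : ℕ) → Fin m → Fin m → ℤ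
oddFormula m q i j =
  (+ q - + (2 ℕ.* m)) ℤ.^ toℕ i
  * (+ q - + (2 ℕ.* m) + + 1) ℤ.^ (toℕ j ℕ.∸ toℕ i)
  * (+ q - + (2 ℕ.* m) + + 2) ℤ.^ (m ℕ.∸ suc (toℕ j))
evenFormula m q i j =
  (+ q - + (2 ℕ.* m)) ℤ.^ toℕ i
  * (+ q - + (2 ℕ.* m) + + 1) ℤ.^ (toℕ j ℕ.∸ toℕ i ℕ.∸ 1)
  * ((+ q - + (2 ℕ.* m) + + 2) ℤ.^ (m ℕ.∸ suc (toℕ j) ℕ.+ 1)
     - (+ q - + (2 ℕ.* m) + + 1) ℤ.^ (m ℕ.∸ suc (toℕ j)))

{-# OPTIONS --safe #-}

-- A point is read as a word. Up to sign, the residues modulo q are arranged in levels; level d holds the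
-- residue n − d and its negative, and each level is empty or holds one signed coordinate. With the signed
-- coordinates ordered +1 < … < +m < −m < … < −1, avoiding the hyperplanes means that the letters increase
-- along every run of occupied levels, that the first run has only negative letters and, for even q, that
-- the last one has only positive letters. A run is thus a set, so a word amounts to a choice of a block
-- (between consecutive empty levels) and a sign for each coordinate, independently, and the number of
-- words is a product. On x_i + x_j = 1 the letters of i and j are adjacent, as (−j , +i) or (−i , +j); this
-- descending pair separates two blocks like an empty level, except that the coordinates k < j (k < i)
-- lose one choice on the side of j (of i), and its place is one of the separators. For even q the pair
-- (−i , +j) cannot be on the last two levels, which gives the subtracted term.
module Submission where

open import Defs
open import Data.Bool using (if_then_else_)
open import Data.Fin as Fin using (Fin; toℕ)
import Data.Fin.Properties as FinP
open import Data.Integer as ℤ using (ℤ; ∣_∣; _⊖_)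
import Data.Integer.Properties as ℤP
import Data.Integer.Tactic.RingSolver as ℤSolver
open import Data.List
  using (List; []; _∷_; _++_; length; map; filter; concatMap; tabulate; allFin; upTo; applyUpTo; downFrom)
open import Data.List.Membership.Propositional using (_∈_; lose; find)
open import Data.List.Membership.Propositional.Properties
  using (∈-filter⁺; ∈-filter⁻; ∈-++⁺ˡ; ∈-++⁺ʳ; ∈-++⁻; ∈-concatMap⁺; ∈-concatMap⁻; ∈-map⁺; ∈-allFin; ∈-∃++)
open import Data.List.Properties using (length-tabulate; upTo-∷ʳ)
open import Data.List.Relation.Binary.Permutation.Propositional
  using (_↭_; ↭-refl; ↭-sym; ↭-trans; ↭-reflexive; prep; swap; ↭⇒↭ₛ)
open import Data.List.Relation.Binary.Permutation.Propositional.Properties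
  using (↭-length; ∈-resp-↭; shift)
import Data.List.Relation.Binary.Permutation.Setoid.Properties as SetoidPerm
open import Data.List.Relation.Unary.All as All using (All; []; _∷_)
open import Data.List.Relation.Unary.AllPairs as AllPairs using ([]; _∷_)
open import Data.List.Relation.Unary.Any using (here; there)
open import Data.List.Relation.Unary.Unique.Propositional using (Unique)
open import Data.List.Relation.Unary.Unique.Propositional.Properties using (allFin⁺)
open import Data.Nat using (ℕ; zero; suc; _+_; _*_; _^_; _∸_; _≤_; _<_; _≤?_; _≟_; z≤n; s≤s; NonZero)
open import Data.Nat.Divisibility using (_∣_; divides; _∣0; ∣-refl; >⇒∤)
open import Data.Nat.Properties
open import Data.Nat.Tactic.RingSolver using (solve-∀)
open import Data.Product using (_×_; _,_; proj₁; proj₂; ∃; ∃-syntax)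
open import Data.Sum using (_⊎_; inj₁; inj₂) renaming (swap to swap⊎)
open import Data.Vec as Vec using (Vec; []; _∷_; lookup)
open import Data.Vec.Properties using (lookup∘tabulate; lookup-zipWith)
open import Function using (_∘_; id)
open import Relation.Binary.Definitions using (tri<; tri≈; tri>)
open import Relation.Binary.PropositionalEquality
open import Relation.Nullary using (Dec; does; yes; no; ¬_; contradiction)
open import Relation.Nullary.Decidable using (¬?; _×-dec_)

-- Sums, products and indicators

-- The expected product treats all coordinates alike, whereas words are read level by level, so the
-- independence of the choices is invisible in the recursion. `telescope` is the bridge: it expands
-- a product of sums according to the smallest letter of the current block. For both recursions to
-- agree, every count carries a start rank `r`, the least rank that the current run still accepts,
-- and the number `E` of empty levels to come, which is the number of later blocks. The conditions
-- at both ends become values of parameters: start rank `m` leaves only negative letters to the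
-- first run, and bound `m` leaves only positive letters to the last one.
--
-- For the pair, inclusion-exclusion shows that every block that can hold it yields the same
-- product, so the number of blocks splits off as a factor. With `2 + E` empty levels it is `3 + E`,
-- and both orders of the pair give `6 + 2 * E`. This equals `q - 2m + 1` for odd `q` and
-- `q - 2m + 2` for even `q`, which is why the extra power belongs to different bases in the two
-- formulas.

private variable
  A B : Set

∑ ∏ : List A → (A → ℕ) → ℕ
∑ []       f = 0
∑ (x ∷ xs) f = f x + ∑ xs f
∏ []       f = 1
∏ (x ∷ xs) f = f x * ∏ xs f

∑-cong : ∀ (xs : List A) {f g} → (∀ {x} → x ∈ xs → f x ≡ g x) → ∑ xs f ≡ ∑ xs g
∑-cong []       h = refl
∑-cong (x ∷ xs) h = cong₂ _+_ (h (here refl)) (∑-cong xs (h ∘ there))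

∏-cong : ∀ (xs : List A) {f g} → (∀ {x} → x ∈ xs → f x ≡ g x) → ∏ xs f ≡ ∏ xs g
∏-cong []       h = refl
∏-cong (x ∷ xs) h = cong₂ _*_ (h (here refl)) (∏-cong xs (h ∘ there))

∑-++ : ∀ (xs : List A) ys {f} → ∑ (xs ++ ys) f ≡ ∑ xs f + ∑ ys f
∑-++ []       ys     = refl
∑-++ (x ∷ xs) ys {f} = trans (cong (f x +_) (∑-++ xs ys)) (sym (+-assoc (f x) _ _))

∑-zero : ∀ (xs : List A) {f} → (∀ {x} → x ∈ xs → f x ≡ 0) → ∑ xs f ≡ 0
∑-zero []       h = refl
∑-zero (x ∷ xs) h = cong₂ _+_ (h (here refl)) (∑-zero xs (h ∘ there))

+-interchange : ∀ a b c d → (a + b) + (c + d) ≡ (a + c) + (b + d)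
+-interchange = solve-∀

∑-+ : ∀ (xs : List A) {f g} → ∑ xs (λ x → f x + g x) ≡ ∑ xs f + ∑ xs g
∑-+ []               = refl
∑-+ (x ∷ xs) {f} {g} =
  trans (cong (f x + g x +_) (∑-+ xs)) (+-interchange (f x) (g x) _ _)

∑-* : ∀ (xs : List A) c {f} → c * ∑ xs f ≡ ∑ xs (λ x → c * f x)
∑-* []       c     = *-zeroʳ c
∑-* (x ∷ xs) c {f} = trans (*-distribˡ-+ c (f x) _) (cong (c * f x +_) (∑-* xs c))

∑-swap : ∀ (xs : List A) (ys : List B) {f : A → B → ℕ} →
         ∑ xs (λ x → ∑ ys (f x)) ≡ ∑ ys (λ y → ∑ xs (λ x → f x y))
∑-swap []       ys = sym (∑-zero ys λ _ → refl)
∑-swap (x ∷ xs) ys {f} = trans (cong (∑ ys (f x) +_) (∑-swap xs ys)) (sym (∑-+ ys))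

∏-zero : ∀ (xs : List A) {f} → 0 < length xs → (∀ x → f x ≡ 0) → ∏ xs f ≡ 0
∏-zero (x ∷ xs) _ h rewrite h x = refl

∏-↭ : ∀ {xs ys : List A} {f} → xs ↭ ys → ∏ xs f ≡ ∏ ys f
∏-↭ _↭_.refl = refl
∏-↭ {f = f} (prep x p) = cong (f x *_) (∏-↭ p)
∏-↭ {f = f} (swap x y p) = trans (cong (λ z → f x * (f y * z)) (∏-↭ p)) (lem (f x) (f y) _)
  where
  lem : ∀ a b c → a * (b * c) ≡ b * (a * c)
  lem = solve-∀
∏-↭ (_↭_.trans p q) = trans (∏-↭ p) (∏-↭ q)

-- Serves for the choice of the letter to be read next; the second argument of `f` is the list of
-- letters still to be placed.
pickSum : List A → (A → List A → ℕ) → ℕ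
pickSum []       f = 0
pickSum (x ∷ xs) f = f x xs + pickSum xs (λ y ys → f y (x ∷ ys))

pickSum-cong : ∀ (xs : List A) {f g} →
               (∀ x xs′ → x ∷ xs′ ↭ xs → f x xs′ ≡ g x xs′) → pickSum xs f ≡ pickSum xs g
pickSum-cong []       h = refl
pickSum-cong (x ∷ xs) h = cong₂ _+_ (h x xs ↭-refl)
  (pickSum-cong xs λ y ys p → h y (x ∷ ys) (↭-trans (swap y x ↭-refl) (prep x p)))

pickSum-+ : ∀ (xs : List A) {f g} →
            pickSum xs (λ x ys → f x ys + g x ys) ≡ pickSum xs f + pickSum xs g
pickSum-+ []               = refl
pickSum-+ (x ∷ xs) {f} {g} =
  trans (cong (f x xs + g x xs +_) (pickSum-+ xs)) (+-interchange (f x xs) _ _ _)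

pickSum-* : ∀ (xs : List A) c {f} → c * pickSum xs f ≡ pickSum xs (λ x ys → c * f x ys)
pickSum-* []       c     = *-zeroʳ c
pickSum-* (x ∷ xs) c {f} = trans (*-distribˡ-+ c (f x xs) _) (cong (c * f x xs +_) (pickSum-* xs c))

pickSum-zero : ∀ (xs : List A) {f} →
               (∀ x xs′ → x ∷ xs′ ↭ xs → f x xs′ ≡ 0) → pickSum xs f ≡ 0
pickSum-zero xs h = trans (pickSum-cong xs h) (zeros xs)
  where
  zeros : ∀ (xs : List A) → pickSum xs (λ _ _ → 0) ≡ 0
  zeros []       = refl
  zeros (x ∷ xs) = zeros xs

∑-pickSum : ∀ (vs : List B) (xs : List A) {f : B → A → List A → ℕ} →
            ∑ vs (λ v → pickSum xs (f v)) ≡ pickSum xs (λ x ys → ∑ vs (λ v → f v x ys))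
∑-pickSum []       xs = sym (pickSum-zero xs λ _ _ _ → refl)
∑-pickSum (v ∷ vs) xs {f} =
  trans (cong (pickSum xs (f v) +_) (∑-pickSum vs xs)) (sym (pickSum-+ xs))

ind : ∀ {P : Set} → Dec P → ℕ
ind p = if does p then 1 else 0

ind-yes : ∀ {P : Set} (p : Dec P) → P → ind p ≡ 1
ind-yes (yes _) _ = refl
ind-yes (no ¬p) p = contradiction p ¬p

ind-no : ∀ {P : Set} (p : Dec P) → ¬ P → ind p ≡ 0
ind-no (yes p) ¬p = contradiction p ¬p
ind-no (no _)  _  = refl

le : ℕ → ℕ → ℕ
le x y = ind (x ≤? y)

le-yes : ∀ {x y} → x ≤ y → le x y ≡ 1
le-yes = ind-yes (_ ≤? _)

le-no : ∀ {x y} → y < x → le x y ≡ 0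
le-no = ind-no (_ ≤? _) ∘ <⇒≱

-- Exactly one of two distinct ranks is the smaller, and it takes over the role of `r` as lower
-- bound for the other.
le-split : ∀ r {x y} → x ≢ y → le r x * le r y ≡ le r x * le (suc x) y + le r y * le (suc y) x
le-split r {x} {y} x≢y with <-cmp x y
... | tri≈ _ x≡y _ = contradiction x≡y x≢y
... | tri< x<y _ _ rewrite le-yes x<y | le-no {suc y} {x} (m<n⇒m<1+n x<y) | *-zeroʳ (le r y) | +-identityʳ
    (le r x * 1)
  with ≤-<-connex r x
...   | inj₁ r≤x rewrite le-yes r≤x | le-yes (≤-trans r≤x (<⇒≤ x<y)) = refl
...   | inj₂ x<r rewrite le-no x<r = refl
le-split r {x} {y} x≢y | tri> _ _ y<x rewrite le-yes y<x | le-no {suc x} {y} (m<n⇒m<1+n y<x) | *-zeroʳ (le r x)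
  with ≤-<-connex r y
...   | inj₁ r≤y rewrite le-yes r≤y | le-yes (≤-trans r≤y (<⇒≤ y<x)) = refl
...   | inj₂ y<r rewrite le-no y<r | *-zeroʳ (le r x) = refl

data Sgn : Set where
  pos neg : Sgn

∑± : (Sgn → ℕ) → ℕ
∑± f = f pos + f neg

∑±-cong : ∀ {f g} → (∀ σ → f σ ≡ g σ) → ∑± f ≡ ∑± g
∑±-cong h = cong₂ _+_ (h pos) (h neg)

-- Telescoping over the first letter of a block

module Telescoping {K : Set} (ρ : K → Sgn → ℕ)
  (ρ-distinct : ∀ {k l} → k ≢ l → ∀ σ τ → ρ k σ ≢ ρ l τ) where

  open ≡-Reasoning

  from : (ℕ → ℕ) → ℕ → K → ℕ
  from b r k = ∑± λ σ → le r (ρ k σ) * b (ρ k σ)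

  module _ (b : ℕ → ℕ) (R : K → ℕ) where

    -- `R k` counts the places of `k` outside the current block, so this counts all its places when
    -- that block still accepts ranks from `r` on.
    factor : ℕ → K → ℕ
    factor r k = R k + from b r k

    g : ℕ → ℕ → ℕ
    g r x = le r x * b x

    g-split : ∀ r {x y} → x ≢ y → g r x * g r y ≡ g r x * g (suc x) y + g r y * g (suc y) x
    g-split r {x} {y} x≢y =
      trans (pull (le r x) (le r y) (b x) (b y))
        (trans (cong (_* (b x * b y)) (le-split r x≢y)) (push (le r x) (le r y) (le (suc x) y) (le (suc y) x)
            (b x) (b y)))
      where
      pull : ∀ p q u v → (p * u) * (q * v) ≡ (p * q) * (u * v)
      pull = solve-∀
      push : ∀ p q r s u v → (p * r + q * s) * (u * v) ≡ (p * u) * (r * v) + (q * v) * (s * u)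
      push = solve-∀

    -- Classification by the smallest letter of the current block, if that block has one.
    telescope : ∀ S → Unique S → ∀ r →
      ∏ S (factor r) ≡
      ∏ S R + pickSum S λ k S′ → ∑± λ σ → g r (ρ k σ) * ∏ S′ (factor (suc (ρ k σ)))
    telescope [] _ r = refl
    telescope (k ∷ S) (k∉S ∷ uS) r = begin
      factor r k * ∏ S (factor r)
        ≡⟨ cong (factor r k *_) (telescope S uS r) ⟩
      factor r k * (∏ S R + pickSum S (first r))
        ≡⟨ *-distribˡ-+ (factor r k) _ _ ⟩
      factor r k * ∏ S R + factor r k * pickSum S (first r)
        ≡⟨ cong (factor r k * ∏ S R +_) (trans (pickSum-* S (factor r k)) (pickSum-cong S split)) ⟩
      factor r k * ∏ S R + pickSum S (λ l S′ → kThenL l S′ + lThenK l S′)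
        ≡⟨ cong (factor r k * ∏ S R +_) (pickSum-+ S) ⟩
      factor r k * ∏ S R + (pickSum S kThenL + pickSum S lThenK)
        ≡⟨ cong (λ z → factor r k * ∏ S R + (z + pickSum S lThenK))
             (trans (pickSum-+ S) (sym (cong₂ _+_ (pickSum-* S (gk pos)) (pickSum-* S (gk neg))))) ⟩
      factor r k * ∏ S R + ((gk pos * pickSum S (first (suc (ρ k pos))) + gk neg * pickSum S
          (first (suc (ρ k neg)))) + pickSum S lThenK)
        ≡⟨ regroup (R k) (gk pos) (gk neg) (∏ S R) _ _ _ ⟩
      R k * ∏ S R + ((gk pos * (∏ S R + pickSum S (first (suc (ρ k pos))))
                      + gk neg * (∏ S R + pickSum S (first (suc (ρ k neg))))) + pickSum S lThenK)
        ≡⟨ cong (λ z → R k * ∏ S R + (z + pickSum S lThenK))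
             (sym (∑±-cong λ σ → cong (gk σ *_) (telescope S uS (suc (ρ k σ))))) ⟩
      R k * ∏ S R + (∑± (λ σ → gk σ * ∏ S (factor (suc (ρ k σ)))) + pickSum S lThenK) ∎
      where
      gk : Sgn → ℕ
      gk σ = g r (ρ k σ)
      first : ℕ → K → List K → ℕ
      first r l S′ = ∑± λ τ → g r (ρ l τ) * ∏ S′ (factor (suc (ρ l τ)))
      kThenL lThenK : K → List K → ℕ
      kThenL l S′ = ∑± λ σ → gk σ * first (suc (ρ k σ)) l S′
      lThenK l S′ = ∑± λ τ → g r (ρ l τ) * (factor (suc (ρ l τ)) k * ∏ S′ (factor (suc (ρ l τ))))
      regroup : ∀ R p q P x y z → (R + (p + q)) * P + ((p * x + q * y) + z) ≡
                                  R * P + ((p * (P + x) + q * (P + y)) + z)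
      regroup = solve-∀
      -- With `l` the smallest letter of the block among `S`, the new coordinate `k` comes before
      -- `l`, after `l`, or lies outside the block. The first case is `kThenL`; the other two make
      -- up `factor` at `k` in `lThenK`.
      split : ∀ l S′ → l ∷ S′ ↭ S → factor r k * first r l S′ ≡ kThenL l S′ + lThenK l S′
      split l S′ p = algebra (R k) (gk pos) (gk neg) (g r (ρ l pos)) (g r (ρ l neg)) _ _ _ _ _ _ _ _ _ _
        (g-split r (ρ-distinct k≢l pos pos)) (g-split r (ρ-distinct k≢l pos neg))
        (g-split r (ρ-distinct k≢l neg pos)) (g-split r (ρ-distinct k≢l neg neg))
        where
        k≢l : k ≢ l
        k≢l = All.lookup k∉S (∈-resp-↭ p (here refl))
        expand : ∀ R a a′ c c′ y y′ → (R + (a + a′)) * (c * y + c′ * y′) ≡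
          R * (c * y + c′ * y′) + ((a * c * y + a * c′ * y′) + (a′ * c * y + a′ * c′ * y′))
        expand = solve-∀
        collect : ∀ R a a′ c c′ y y′ p p′ q q′ t t′ s s′ →
          R * (c * y + c′ * y′) + (((a * p + c * t) * y + (a * p′ + c′ * t′) * y′) +
              ((a′ * q + c * s) * y + (a′ * q′ + c′ * s′) * y′))
          ≡ (a * (p * y + p′ * y′) + a′ * (q * y + q′ * y′)) +
              (c * ((R + (t + s)) * y) + c′ * ((R + (t′ + s′)) * y′))
        collect = solve-∀
        algebra : ∀ R a a′ c c′ y y′ p p′ q q′ t t′ s s′ →
          a * c ≡ a * p + c * t → a * c′ ≡ a * p′ + c′ * t′ →
          a′ * c ≡ a′ * q + c * s → a′ * c′ ≡ a′ * q′ + c′ * s′ →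
          (R + (a + a′)) * (c * y + c′ * y′) ≡
          (a * (p * y + p′ * y′) + a′ * (q * y + q′ * y′)) + (c * ((R + (t + s)) * y) + c′ * ((R + (t′ + s′)) * y′))
        algebra R a a′ c c′ y y′ p p′ q q′ t t′ s s′ e₁ e₂ e₃ e₄ =
          trans (expand R a a′ c c′ y y′)
            (trans (cong₂ (λ u v → R * (c * y + c′ * y′) + (u + v))
                      (cong₂ _+_ (cong (_* y) e₁) (cong (_* y′) e₂))
                      (cong₂ _+_ (cong (_* y) e₃) (cong (_* y′) e₄)))
              (collect R a a′ c c′ y y′ p p′ q q′ t t′ s s′))

Unique-↭ : ∀ {A : Set} {xs ys : List A} → xs ↭ ys → Unique ys → Unique xs
Unique-↭ p = SetoidPerm.Unique-resp-↭ (setoid _) (↭⇒↭ₛ (↭-sym p))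

-- Words read from the highest level down to level 0

-- The letters of the last block, which ends on level 0, must have rank below a.
allowed : ℕ → ℕ → ℕ → ℕ
allowed a zero    x = le (suc x) a
allowed a (suc _) x = 1

module Words {K : Set} (ρ : K → Sgn → ℕ)
  (ρ-distinct : ∀ {k l} → k ≢ l → ∀ σ τ → ρ k σ ≢ ρ l τ) (a : ℕ) where

  open Telescoping ρ ρ-distinct public
  open ≡-Reasoning

  -- An empty level resets the lower bound `r`, a letter raises it past its own rank. The condition
  -- `allowed` acts on level 0 alone, which suffices because the letter there is the largest of its
  -- block.
  words : ℕ → List K → ℕ → ℕ
  words zero    []      r = 1
  words zero    (_ ∷ _) r = 0
  words (suc n) S       r = words n S 0 +
    pickSum S λ k S′ → ∑± λ σ → le r (ρ k σ) * allowed a n (ρ k σ) * words n S′ (suc (ρ k σ))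

  words-too-long : ∀ n S r → n < length S → words n S r ≡ 0
  words-too-long zero    (k ∷ S) r n<S = refl
  words-too-long (suc n) S r n<S = cong₂ _+_ (words-too-long n S 0 (<-trans (n<1+n n) n<S))
    (pickSum-zero S λ k S′ p → ∑±-cong {λ σ → le r (ρ k σ) * allowed a n (ρ k σ) * words n S′ (suc (ρ k σ))}
        {λ _ → 0} λ σ →
      trans (cong (le r (ρ k σ) * allowed a n (ρ k σ) *_)
              (words-too-long n S′ (suc (ρ k σ)) (≤-pred (subst (suc n <_) (sym (↭-length p)) n<S))))
            (*-zeroʳ (le r (ρ k σ) * allowed a n (ρ k σ))))

  -- The number of choices of block and sign for k among the last E blocks.
  later : ℕ → K → ℕ
  later zero    k = 0
  later (suc E) k = later E k + ∑± λ σ → allowed a E (ρ k σ)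

  -- Nothing can follow a letter that is not allowed in the last block.
  last-block : ∀ n r x S → n ≡ length S →
    le r x * allowed a n x * ∏ S (factor (allowed a 0) (later 0) (suc x)) ≡
    le r x * allowed a 0 x * ∏ S (factor (allowed a 0) (later 0) (suc x))
  last-block zero    r x S       eq = refl
  last-block (suc n) r x (k ∷ S) eq with ≤-<-connex a x
  ... | inj₂ x<a rewrite le-yes x<a = refl
  ... | inj₁ a≤x = trans (cong (le r x * 1 *_) dead)
        (trans (*-zeroʳ (le r x * 1)) (sym (trans (cong (le r x * le (suc x) a *_) dead)
            (*-zeroʳ (le r x * le (suc x) a)))))
    where
    blocked : ∀ y → le (suc x) y * le (suc y) a ≡ 0
    blocked y with ≤-<-connex y x
    ... | inj₁ y≤x rewrite le-no (s≤s y≤x) = refl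
    ... | inj₂ x<y rewrite le-no {suc y} {a} (s≤s (≤-trans a≤x (<⇒≤ x<y))) = *-zeroʳ (le (suc x) y)
    dead : ∏ (k ∷ S) (factor (allowed a 0) (later 0) (suc x)) ≡ 0
    dead = ∏-zero (k ∷ S) (s≤s z≤n) λ l → cong₂ _+_ (blocked (ρ l pos)) (blocked (ρ l neg))

  rest-length : ∀ {k : K} {S′ S n} E → k ∷ S′ ↭ S → suc n ≡ E + length S → n ≡ E + length S′
  rest-length {S′ = S′} E p eq =
    suc-injective (trans eq (trans (cong (E +_) (sym (↭-length p))) (+-suc E (length S′))))

  -- Reading one level matches one expansion by `telescope`: an empty level gives the term without
  -- letters in the current block, a letter gives the term in which it is the smallest. The index of
  -- `allowed` is now the number of blocks after the current one, so that 0 marks the last block.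
  words-closed : ∀ n E S r → Unique S → n ≡ E + length S →
                 words n S r ≡ ∏ S (factor (allowed a E) (later E) r)
  words-closed zero zero [] r uS eq = refl
  words-closed (suc n) zero S@(_ ∷ _) r uS eq =
    -- No empty level is left, so the first summand vanishes; `∏ S (later 0)` vanishes as well
    -- because `S` is nonempty.
    trans (cong₂ _+_ (words-too-long n S 0 (≤-reflexive eq)) (pickSum-cong S step))
      (sym (trans (telescope (allowed a 0) (later 0) S uS r)
             (cong (_+ pickSum S λ k S′ → ∑± λ σ → g (allowed a 0) (later 0) r (ρ k σ) * ∏ S′
                 (factor (allowed a 0) (later 0) (suc (ρ k σ)))) (∏-zero S (s≤s z≤n) λ _ → refl))))
    where
    step : ∀ k S′ → k ∷ S′ ↭ S →
      (∑± λ σ → le r (ρ k σ) * allowed a n (ρ k σ) * words n S′ (suc (ρ k σ))) ≡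
      (∑± λ σ → g (allowed a 0) (later 0) r (ρ k σ) * ∏ S′ (factor (allowed a 0) (later 0) (suc (ρ k σ))))
    step k S′ p = ∑±-cong λ σ →
      trans (cong (le r (ρ k σ) * allowed a n (ρ k σ) *_) (words-closed n 0 S′ (suc (ρ k σ))
          (AllPairs.tail (Unique-↭ p uS)) (rest-length 0 p eq)))
            (last-block n r (ρ k σ) S′ (rest-length 0 p eq))
  words-closed (suc n) (suc E) S r uS eq =
    trans (cong₂ _+_
            (trans (words-closed n E S 0 uS (suc-injective eq))
                   (∏-cong S λ {k} _ → cong (later E k +_) (∑±-cong λ σ → +-identityʳ (allowed a E (ρ k σ)))))
            (pickSum-cong S step))
      (sym (telescope (allowed a (suc E)) (later (suc E)) S uS r))
    where
    step : ∀ k S′ → k ∷ S′ ↭ S →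
      (∑± λ σ → le r (ρ k σ) * allowed a n (ρ k σ) * words n S′ (suc (ρ k σ))) ≡
      (∑± λ σ → g (allowed a (suc E)) (later (suc E)) r (ρ k σ) * ∏ S′
          (factor (allowed a (suc E)) (later (suc E)) (suc (ρ k σ))))
    step k S′ p = ∑±-cong λ σ → cong₂ (λ u v → le r (ρ k σ) * u * v)
      -- An empty level is still to come, so `n` is positive and both sides are 1.
      (cong (λ z → allowed a z (ρ k σ)) (rest-length (suc E) p eq))
      (words-closed n (suc E) S′ (suc (ρ k σ)) (AllPairs.tail (Unique-↭ p uS)) (rest-length (suc E) p eq))

  -- Words with n + 2 levels containing a pair of adjacent letters of ranks f and s, in this order,
  -- that is exempt from the monotonicity condition.

  module Pairs (f s : ℕ) (s<a : s < a) where

    -- Letters read before the pair are on level 2 or higher, so `allowed` enters only through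
    -- `words` after the pair; `s < a` makes the second letter of the pair admissible on level 0.
    pairWords : ℕ → List K → ℕ → ℕ
    pairWords zero    S r = le r f * words zero S (suc s)
    pairWords (suc n) S r = le r f * words (suc n) S (suc s) +
      (pairWords n S 0 + pickSum S λ k S′ → ∑± λ σ → le r (ρ k σ) * pairWords n S′ (suc (ρ k σ)))

    pairWords-too-long : ∀ n S r → n < length S → pairWords n S r ≡ 0
    pairWords-too-long zero    (k ∷ S) r n<S = *-zeroʳ (le r f)
    pairWords-too-long (suc n) S r n<S = cong₂ _+_
      (trans (cong (le r f *_) (words-too-long (suc n) S (suc s) n<S)) (*-zeroʳ (le r f)))
      (cong₂ _+_ (pairWords-too-long n S 0 (<-trans (n<1+n n) n<S))
        (pickSum-zero S λ k S′ p → ∑±-cong {λ σ → le r (ρ k σ) * pairWords n S′ (suc (ρ k σ))} {λ _ → 0} λ σ →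
          trans (cong (le r (ρ k σ) *_)
                  (pairWords-too-long n S′ (suc (ρ k σ)) (≤-pred (subst (suc n <_) (sym (↭-length p)) n<S))))
                (*-zeroʳ (le r (ρ k σ)))))

    below : ℕ → ℕ
    below x = le (suc x) f

    -- Choices for k outside the current block when the pair is in the current block.
    afterPair : ℕ → K → ℕ
    afterPair E = factor (allowed a E) (later E) (suc s)

    -- Choices for k outside the current block when the pair is in one of the E later blocks;
    -- the number does not depend on which one.
    outside : ℕ → K → ℕ
    outside zero    k = 0
    outside (suc E) = factor below (afterPair E) 0

    one : ℕ → ℕ
    one _ = 1

    -- Inclusion-exclusion for the allowed ranks and the ranks above `s`: together they exhaust all
    -- ranks because `s < a`.
    cover : ∀ E x → allowed a E x + le (suc s) x * 1 ≡ le (suc s) x * allowed a E x + le 0 x * 1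
    cover (suc E) x = +-comm 1 (le (suc s) x * 1)
    cover zero    x with ≤-<-connex x s
    ... | inj₁ x≤s rewrite le-no (s≤s x≤s) | le-yes (≤-trans (s≤s x≤s) s<a) = refl
    ... | inj₂ s<x rewrite le-yes s<x | +-identityʳ (le (suc x) a) = refl

    -- Moving the pair from the next block to the one after it replaces "above `s`" plus "allowed"
    -- by "any letter" plus "above `s` and allowed"; `cover` makes the two totals equal.
    outside-step : ∀ E k → factor one (outside (suc E)) 0 k ≡ outside (suc (suc E)) k
    outside-step E k = sym (algebra (later E k) (al pos) (al neg) (gt pos * 1) (gt neg * 1) (gt pos * al pos)
        (gt neg * al neg) 1 1 (from below 0 k) (cover E (ρ k pos)) (cover E (ρ k neg)))
      where
      al gt : Sgn → ℕ
      al σ = allowed a E (ρ k σ)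
      gt σ = le (suc s) (ρ k σ)
      regroup : ∀ c x x′ z z′ w → ((c + (x + x′)) + (z + z′)) + w ≡ c + ((x + z) + (x′ + z′)) + w
      regroup = solve-∀
      regroup′ : ∀ c y y′ v v′ w → c + ((y + v) + (y′ + v′)) + w ≡ ((c + (y + y′)) + w) + (v + v′)
      regroup′ = solve-∀
      algebra : ∀ c x x′ z z′ y y′ v v′ w → x + z ≡ y + v → x′ + z′ ≡ y′ + v′ →
                ((c + (x + x′)) + (z + z′)) + w ≡ ((c + (y + y′)) + w) + (v + v′)
      algebra c x x′ z z′ y y′ v v′ w e e′ = trans (regroup c x x′ z z′ w)
        (trans (cong₂ (λ p q → c + (p + q) + w) e e′) (regroup′ c y y′ v v′ w))

    -- A letter of rank at least `r` and below `f` forces `r ≤ f`, so `le r f` can be taken out of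
    -- the sum over first letters.
    absorb : ∀ r x → le r x * below x ≡ le r f * (le r x * below x)
    absorb r x with ≤-<-connex r f
    ... | inj₁ r≤f rewrite le-yes r≤f = sym (+-identityʳ _)
    ... | inj₂ f<r rewrite le-no f<r with ≤-<-connex r x
    ...   | inj₂ x<r rewrite le-no x<r = refl
    ...   | inj₁ r≤x rewrite le-no {suc x} {f} (m<n⇒m<1+n (<-≤-trans f<r r≤x)) = *-zeroʳ (le r x)

    -- The first summand has the pair in the current block, the second in one of the `E` later
    -- blocks, which contribute equally. Both are expanded by `telescope`: ahead of the pair its
    -- block accepts only ranks below `f`, while a current block without the pair accepts every
    -- rank.
    pairWords-closed : ∀ n E S r → Unique S → n ≡ E + length S →
      pairWords n S r ≡ le r f * ∏ S (factor below (afterPair E) r) + E * ∏ S (factor one (outside E) r)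
    pairWords-closed zero zero [] r uS eq = sym (+-identityʳ (le r f * 1))
    pairWords-closed (suc n) E S r uS eq = begin
      le r f * words (suc n) S (suc s) + (pairWords n S 0 + pickSum S next)
        ≡⟨ cong₂ (λ u v → le r f * u + v) (words-closed (suc n) E S (suc s) uS eq)
             (cong₂ _+_ (skip E eq) (trans (pickSum-cong S step)
               (trans (pickSum-+ S) (sym (cong₂ _+_ (pickSum-* S (le r f)) (pickSum-* S E)))))) ⟩
      le r f * ∏ S (afterPair E) + (E * ∏ S (outside E) + (le r f * pickSum S near + E * pickSum S far))
        ≡⟨ regroup (le r f) E _ _ _ _ ⟩
      le r f * (∏ S (afterPair E) + pickSum S near) + E * (∏ S (outside E) + pickSum S far)
        ≡⟨ sym (cong₂ (λ u v → le r f * u + E * v)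
             (telescope below (afterPair E) S uS r) (telescope one (outside E) S uS r)) ⟩
      le r f * ∏ S (factor below (afterPair E) r) + E * ∏ S (factor one (outside E) r) ∎
      where
      next near far : K → List K → ℕ
      next k S′ = ∑± λ σ → le r (ρ k σ) * pairWords n S′ (suc (ρ k σ))
      near k S′ = ∑± λ σ → le r (ρ k σ) * below (ρ k σ) * ∏ S′ (factor below (afterPair E) (suc (ρ k σ)))
      far  k S′ = ∑± λ σ → le r (ρ k σ) * 1 * ∏ S′ (factor one (outside E) (suc (ρ k σ)))
      regroup : ∀ p E x y z w → p * x + (E * y + (p * z + E * w)) ≡ p * (x + z) + E * (y + w)
      regroup = solve-∀
      -- Past the empty level the pair is in the block that now begins or in a later one;
      -- `outside-step` gives both cases the same product.
      skip : ∀ E → suc n ≡ E + length S → pairWords n S 0 ≡ E * ∏ S (outside E)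
      skip zero          eq = pairWords-too-long n S 0 (≤-reflexive eq)
      skip (suc zero)    eq = trans (pairWords-closed n 0 S 0 uS (suc-injective eq)) (+-identityʳ _)
      skip (suc (suc E)) eq = trans (pairWords-closed n (suc E) S 0 uS (suc-injective eq))
        (cong₂ (λ u v → u + suc E * v) (+-identityʳ (∏ S (outside (suc (suc E)))))
            (∏-cong S λ {k} _ → outside-step E k))
      term : ∀ l b P Q p → l * b ≡ p * (l * b) → l * (b * P + E * Q) ≡ p * (l * b * P) + E * (l * 1 * Q)
      term l b P Q p e = trans (split l b P E Q) (trans (cong (λ z → z * P + E * (l * 1 * Q)) e)
          (assoc p (l * b) P E _))
        where
        split : ∀ l b P E Q → l * (b * P + E * Q) ≡ l * b * P + E * (l * 1 * Q)
        split = solve-∀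
        assoc : ∀ p x P E z → p * x * P + E * z ≡ p * (x * P) + E * z
        assoc = solve-∀
      step : ∀ k S′ → k ∷ S′ ↭ S → next k S′ ≡ le r f * near k S′ + E * far k S′
      step k S′ p = trans (∑±-cong λ σ →
          trans (cong (le r (ρ k σ) *_) (pairWords-closed n E S′ (suc (ρ k σ)) (AllPairs.tail (Unique-↭ p uS))
              (rest-length E p eq)))
                (term (le r (ρ k σ)) (below (ρ k σ)) (∏ S′ (factor below (afterPair E) (suc (ρ k σ))))
                    (∏ S′ (factor one (outside E) (suc (ρ k σ)))) (le r f) (absorb r (ρ k σ))))
        (distrib (le r f) E _ _ _ _)
        where
        distrib : ∀ p E x y z w → (p * x + E * y) + (p * z + E * w) ≡ p * (x + z) + E * (y + w)
        distrib = solve-∀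

-- Weighted sums over assignments

-- The sum over all maps x : S → V of the product of the unary weights u l (x l)
-- and of the binary weights w k (x k) l (x l), for k before l in S.
total : {V L : Set} → (L → V → L → V → ℕ) → List V → List L → (L → V → ℕ) → ℕ
total w V []      u = 1
total w V (k ∷ S) u = ∑ V λ v → u k v * total w V S (λ l v′ → u l v′ * w k v l v′)

private variable
  V V′ L : Set

total-cong : ∀ {w : L → V → L → V → ℕ} {U} S {u u′} →
  (∀ {l v} → l ∈ S → v ∈ U → u l v ≡ u′ l v) → total w U S u ≡ total w U S u′
total-cong         []      h = refl
total-cong {w = w} (k ∷ S) h = ∑-cong _ λ {v} v∈U → cong₂ _*_ (h (here refl) v∈U)
  (total-cong S λ {l} {v′} l∈S v′∈U → cong (_* w k v l v′) (h (there l∈S) v′∈U))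

zero⇒product-zero : ∀ {m} n → m ≡ 0 → m * n ≡ 0
zero⇒product-zero n refl = refl

-- Binary weights are compared only where both unary weights are nonzero, since excluded values
-- contribute nothing. This allows residues and levels to disagree on dead cells.
total-cong₂ : ∀ {w w′ : L → V → L → V → ℕ} {U} S {u u′} → Unique S →
  (∀ {l v} → l ∈ S → v ∈ U → u l v ≡ u′ l v) →
  (∀ {k l v v′} → k ∈ S → l ∈ S → k ≢ l → v ∈ U → v′ ∈ U →
     u k v ≢ 0 → u l v′ ≢ 0 → w k v l v′ ≡ w′ k v l v′) →
  total w U S u ≡ total w′ U S u′
total-cong₂ [] uS hu hw = refl
total-cong₂ {w = w} {w′} {U} (k ∷ S) {u} {u′} (k∉S ∷ uS) hu hw = ∑-cong U λ {v} v∈U → step v∈U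
  where
  step : ∀ {v} → v ∈ U →
    u k v * total w U S (λ l v′ → u l v′ * w k v l v′) ≡ u′ k v * total w′ U S (λ l v′ → u′ l v′ * w′ k v l v′)
  step {v} v∈U with u k v ≟ 0
  ... | yes ukv≡0 = trans (zero⇒product-zero _ ukv≡0)
                      (sym (zero⇒product-zero _ (trans (sym (hu (here refl) v∈U)) ukv≡0)))
  ... | no  ukv≢0 = cong₂ _*_ (hu (here refl) v∈U) (total-cong₂ S uS unary
          λ {p} {l} p∈S l∈S p≢l v∈ v′∈ up ul →
            hw (there p∈S) (there l∈S) p≢l v∈ v′∈
              (λ e → up (zero⇒product-zero _ e)) (λ e → ul (zero⇒product-zero _ e)))
    where
    unary : ∀ {l v′} → l ∈ S → v′ ∈ U → u l v′ * w k v l v′ ≡ u′ l v′ * w′ k v l v′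
    unary {l} {v′} l∈S v′∈U with u l v′ ≟ 0
    ... | yes ulv≡0 = trans (zero⇒product-zero _ ulv≡0)
                        (sym (zero⇒product-zero _ (trans (sym (hu (there l∈S) v′∈U)) ulv≡0)))
    ... | no  ulv≢0 = cong₂ _*_ (hu (there l∈S) v′∈U)
            (hw (here refl) (there l∈S) (All.lookup k∉S l∈S) v∈U v′∈U ukv≢0 ulv≢0)

total-vanish : ∀ {w : L → V → L → V → ℕ} W {U} S {u} →
  (∀ {l v} → v ∈ W → u l v ≡ 0) → total w (W ++ U) S u ≡ total w U S u
total-vanish W []      h = refl
total-vanish {w = w} W {U} (k ∷ S) {u} h = trans (∑-++ W U)
  (cong₂ _+_ (∑-zero W λ v∈W → zero⇒product-zero _ (h v∈W))
    (∑-cong U λ {v} _ → cong (u k v *_) (total-vanish W S λ v′∈W → zero⇒product-zero _ (h v′∈W))))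

swap-middle : ∀ a b c → a * b * c ≡ a * c * b
swap-middle = solve-∀

total-↭ : ∀ {w : L → V → L → V → ℕ} → (∀ k v l v′ → w k v l v′ ≡ w l v′ k v) →
  ∀ {U S S′} → S ↭ S′ → ∀ u → total w U S u ≡ total w U S′ u
total-↭ w-sym _↭_.refl u = refl
total-↭ w-sym {U} (prep k p) u = ∑-cong U λ {v} _ → cong (u k v *_) (total-↭ w-sym p _)
total-↭ {w = w} w-sym {U} {k ∷ l ∷ S} {_ ∷ _ ∷ S′} (swap k l p) u =
  trans (∑-cong U λ {v} _ → ∑-* U (u k v))
  (trans (∑-swap U U)
  (∑-cong U λ {v′} _ → trans (∑-cong U λ {v} _ → term v v′) (sym (∑-* U (u l v′)))))
  where
  reorder : ∀ a b c z → a * (b * c * z) ≡ b * (a * c * z)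
  reorder = solve-∀
  term : ∀ v v′ →
    u k v * (u l v′ * w k v l v′ * total w U S (λ p y → u p y * w k v p y * w l v′ p y)) ≡
    u l v′ * (u k v * w l v′ k v * total w U S′ (λ p y → u p y * w l v′ p y * w k v p y))
  term v v′ = trans (reorder (u k v) (u l v′) (w k v l v′) _)
    (cong₂ (λ x y → u l v′ * (u k v * x * y)) (w-sym k v l v′)
      (trans (total-↭ w-sym p _)
        (total-cong S′ λ {q} {y} _ _ → swap-middle (u q y) (w k v q y) (w l v′ q y))))
total-↭ w-sym (_↭_.trans p p′) u = trans (total-↭ w-sym p u) (total-↭ w-sym p′ u)

-- If no two labels can take values in W, then at most one of them does.
total-decompose : ∀ {w : L → V → L → V → ℕ} → (∀ k v l v′ → w k v l v′ ≡ w l v′ k v) →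
  ∀ W {U} → (∀ {k v l v′} → v ∈ W → v′ ∈ W → w k v l v′ ≡ 0) → ∀ S u →
  total w (W ++ U) S u ≡ total w U S u +
    pickSum S λ k S′ → ∑ W λ v → u k v * total w U S′ (λ l v′ → u l v′ * w k v l v′)
total-decompose w-sym W excl [] u = refl
total-decompose {w = w} w-sym W {U} excl (k ∷ S) u = begin
  ∑ (W ++ U) (λ v → u k v * rest (W ++ U) v)
    ≡⟨ ∑-++ W U ⟩
  ∑ W (λ v → u k v * rest (W ++ U) v) + ∑ U (λ v → u k v * rest (W ++ U) v)
    ≡⟨ cong₂ _+_
         (∑-cong W λ {v} v∈W → cong (u k v *_) (total-vanish W S λ {l} {v′} v′∈W →
           trans (cong (u l v′ *_) (excl v∈W v′∈W)) (*-zeroʳ (u l v′))))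
         (∑-cong U λ {v} _ → trans (cong (u k v *_) (total-decompose w-sym W excl S _))
           (*-distribˡ-+ (u k v) _ _)) ⟩
  ∑ W (λ v → u k v * rest U v) + ∑ U (λ v → u k v * rest U v + u k v * pickSum S (inner v))
    ≡⟨ cong (∑ W (λ v → u k v * rest U v) +_) (trans (∑-+ U)
         (cong (∑ U (λ v → u k v * rest U v) +_) (trans (∑-cong U λ {v} _ → pickSum-* S (u k v))
           (trans (∑-pickSum U S) (pickSum-cong S λ l S′ _ → exchange l S′))))) ⟩
  ∑ W (λ v → u k v * rest U v) + (∑ U (λ v → u k v * rest U v) + pickSum S outer)
    ≡⟨ x∙yz≈y∙xz (∑ W (λ v → u k v * rest U v)) (∑ U (λ v → u k v * rest U v)) (pickSum S outer) ⟩
  ∑ U (λ v → u k v * rest U v) + (∑ W (λ v → u k v * rest U v) + pickSum S outer) ∎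
  where
  open ≡-Reasoning
  x∙yz≈y∙xz : ∀ x y z → x + (y + z) ≡ y + (x + z)
  x∙yz≈y∙xz = solve-∀
  rest : List _ → _ → ℕ
  rest X v = total w X S (λ l v′ → u l v′ * w k v l v′)
  inner : _ → _ → List _ → ℕ
  inner v l S′ = ∑ W λ v′ → u l v′ * w k v l v′ * total w U S′ (λ p y → u p y * w k v p y * w l v′ p y)
  outer : _ → List _ → ℕ
  outer l S′ = ∑ W λ v′ → u l v′ * total w U (k ∷ S′) (λ p y → u p y * w l v′ p y)
  reorder : ∀ a b c z → a * (b * c * z) ≡ b * (a * c * z)
  reorder = solve-∀
  exchange : ∀ l S′ → ∑ U (λ v → u k v * inner v l S′) ≡ outer l S′
  exchange l S′ = trans (∑-cong U λ {v} _ → ∑-* W (u k v)) (trans (∑-swap U W)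
    (∑-cong W λ {v′} _ → trans (∑-cong U λ {v} _ →
        trans (reorder (u k v) (u l v′) (w k v l v′) _)
          (cong₂ (λ x y → u l v′ * (u k v * x * y)) (w-sym k v l v′)
            (total-cong S′ λ {q} {y} _ _ → swap-middle (u q y) (w k v q y) (w l v′ q y))))
      (sym (∑-* U (u l v′)))))

total-change-values : ∀ {w : L → V → L → V → ℕ} (val : V′ → V) (c : V′ → ℕ) {U U′} →
  ∀ S u → (∀ {h : V → ℕ} → (∀ v → (∀ l → u l v ≡ 0) → h v ≡ 0) → ∑ U h ≡ ∑ U′ λ x → c x * h (val x)) →
  total w U S u ≡ total (λ k x l x′ → w k (val x) l (val x′)) U′ S (λ l x → c x * u l (val x))
total-change-values val c [] u h = refl
total-change-values {w = w} val c {U} {U′} (k ∷ S) u h =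
  trans (h λ v zeros → zero⇒product-zero _ (zeros k))
    (∑-cong U′ λ {x} _ → trans (sym (*-assoc (c x) (u k (val x)) _))
      (cong (c x * u k (val x) *_)
        (trans (total-change-values val c S _ λ hz → h λ v zeros → hz v λ l → zero⇒product-zero _ (zeros l))
          (total-cong S λ {l} {y} _ _ → sym (*-assoc (c y) (u l (val y)) _)))))

-- Levels

-- Compatibility of letters of ranks x on level d and y on level d′. Level d + 1 is read before level d.
adj : ℕ → ℕ → ℕ → ℕ → ℕ
adj zero          x zero          y = 0
adj zero          x (suc zero)    y = le (suc y) x
adj zero          x (suc (suc _)) y = 1
adj (suc d)       x (suc d′)      y = adj d x d′ y
adj (suc zero)    x zero          y = le (suc x) y
adj (suc (suc _)) x zero          y = 1

adj-sym : ∀ d x d′ y → adj d x d′ y ≡ adj d′ y d x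
adj-sym zero          x zero           y = refl
adj-sym zero          x (suc zero)     y = refl
adj-sym zero          x (suc (suc d′)) y = refl
adj-sym (suc zero)    x zero           y = refl
adj-sym (suc (suc d)) x zero           y = refl
adj-sym (suc d)       x (suc d′)       y = adj-sym d x d′ y

adj-same : ∀ d x y → adj d x d y ≡ 0
adj-same zero    x y = refl
adj-same (suc d) x y = adj-same d x y

adj-next : ∀ d x y → adj (suc d) x d y ≡ le (suc x) y
adj-next zero    x y = refl
adj-next (suc d) x y = adj-next d x y

adj-far : ∀ {d d′} x y → suc d < d′ → adj d′ x d y ≡ 1
adj-far {zero}  {suc (suc _)} x y _             = refl
adj-far {zero}  {suc zero}    x y (s≤s ())
adj-far {suc d} {suc d′}      x y (s≤s d<d′) = adj-far x y d<d′

-- Letters on the topmost of n levels must have rank at least r.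
top : ℕ → ℕ → ℕ → ℕ → ℕ
top (suc n)       r (suc d) y = top n r d y
top (suc zero)    r zero    y = le r y
top _             _ _       _ = 1

top-zero : ∀ n d y → top n 0 d y ≡ 1
top-zero zero          d       y = refl
top-zero (suc zero)    zero    y = refl
top-zero (suc (suc n)) zero    y = refl
top-zero (suc zero)    (suc d) y = refl
top-zero (suc (suc n)) (suc d) y = top-zero (suc n) d y

top-below : ∀ {n d} r y → suc d < n → top n r d y ≡ 1
top-below {suc (suc n)} {zero}  r y _           = refl
top-below {suc (suc n)} {suc d} r y (s≤s d<n) = top-below {suc n} {d} r y d<n
top-below {suc zero} r y (s≤s ())

top-same : ∀ n r y → top (suc n) r n y ≡ le r y
top-same zero    r y = refl
top-same (suc n) r y = top-same n r y

-- Once a letter is read, its binary weight against the levels below acts as a new start rank.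
adj-top : ∀ {n d} x y → d < n → adj n x d y ≡ top n (suc x) d y
adj-top {suc zero}    {zero}  x y _           = refl
adj-top {suc (suc n)} {zero}  x y _           = refl
adj-top {suc (suc n)} {suc d} x y (s≤s d<n) = adj-top {suc n} {d} x y d<n
adj-top {suc zero}    {suc d} x y (s≤s ())

cells : ℕ → List (ℕ × Sgn)
cells zero    = []
cells (suc n) = (n , pos) ∷ (n , neg) ∷ cells n

cells-< : ∀ {n d σ} → (d , σ) ∈ cells n → d < n
cells-< {suc n} (here refl)         = n<1+n n
cells-< {suc n} (there (here refl)) = n<1+n n
cells-< {suc n} (there (there c∈))  = m<n⇒m<1+n (cells-< c∈)

module Levels {K : Set} (ρ : K → Sgn → ℕ)
  (ρ-distinct : ∀ {k l} → k ≢ l → ∀ σ τ → ρ k σ ≢ ρ l τ) where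

  open ≡-Reasoning

  wt : K → ℕ × Sgn → K → ℕ × Sgn → ℕ
  wt k (d , σ) l (d′ , τ) = adj d (ρ k σ) d′ (ρ l τ)

  wt-sym : ∀ k c l c′ → wt k c l c′ ≡ wt l c′ k c
  wt-sym k (d , σ) l (d′ , τ) = adj-sym d (ρ k σ) d′ (ρ l τ)

  level : ℕ → List (ℕ × Sgn)
  level n = (n , pos) ∷ (n , neg) ∷ []

  level-excl : ∀ n {k c l c′} → c ∈ level n → c′ ∈ level n → wt k c l c′ ≡ 0
  level-excl n {k} {_ , σ} {l} {_ , τ} c∈ c′∈ with same c∈ | same c′∈
    where
    same : ∀ {d σ} → (d , σ) ∈ level n → d ≡ n
    same (here refl)         = refl
    same (there (here refl)) = refl
  ... | refl | refl = adj-same n (ρ k σ) (ρ l τ)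

  module _ (a : ℕ) where

    open Words ρ ρ-distinct a using (words)

    free : ℕ → ℕ → K → ℕ × Sgn → ℕ
    free n r l (d , σ) = allowed a d (ρ l σ) * top n r d (ρ l σ)

    free-below : ∀ {n d} r l σ → d < n → free (suc n) r l (d , σ) ≡ allowed a d (ρ l σ)
    free-below {d = d} r l σ d<n = trans (cong (allowed a d (ρ l σ) *_) (top-below r (ρ l σ) (s≤s d<n)))
        (*-identityʳ _)

    free-zero : ∀ n d l σ → free n 0 l (d , σ) ≡ allowed a d (ρ l σ)
    free-zero n d l σ = trans (cong (allowed a d (ρ l σ) *_) (top-zero n d (ρ l σ))) (*-identityʳ _)

    free-top : ∀ n r l σ → free (suc n) r l (n , σ) ≡ le r (ρ l σ) * allowed a n (ρ l σ)
    free-top n r l σ = trans (cong (allowed a n (ρ l σ) *_) (top-same n r (ρ l σ))) (*-comm (allowed a n (ρ l σ)) _)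

    free-skip : ∀ {n d} r l σ → d < n → free (suc n) r l (d , σ) ≡ free n 0 l (d , σ)
    free-skip {n} {d} r l σ d<n = trans (free-below r l σ d<n) (sym (free-zero n d l σ))

    free-place : ∀ {n d} r l σ x → d < n → free (suc n) r l (d , σ) * adj n x d (ρ l σ) ≡ free n (suc x) l (d , σ)
    free-place r l σ x d<n = cong₂ _*_ (free-below r l σ d<n) (adj-top x (ρ l σ) d<n)

    -- At most one letter is on the topmost level, so splitting that level off by `total-decompose`
    -- reproduces the recursion of `words`.
    total-words : ∀ n S r → total wt (cells n) S (free n r) ≡ words n S r
    total-words zero    []      r = refl
    total-words zero    (k ∷ S) r = refl
    total-words (suc n) S       r = trans
      (total-decompose wt-sym (level n) (λ {k} {v} {l} {v′} → level-excl n {k} {v} {l} {v′}) S (free (suc n) r))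
      (cong₂ _+_
        (trans (total-cong S λ {l} {c} _ c∈ → free-skip r l (proj₂ c) (cells-< c∈)) (total-words n S 0))
        (pickSum-cong S λ k S′ _ → cong₂ _+_ (term k S′ pos) (trans (+-identityʳ _) (term k S′ neg))))
      where
      term : ∀ k S′ σ →
        free (suc n) r k (n , σ) * total wt (cells n) S′ (λ l c → free (suc n) r l c * wt k (n , σ) l c) ≡
        le r (ρ k σ) * allowed a n (ρ k σ) * words n S′ (suc (ρ k σ))
      term k S′ σ = cong₂ _*_ (free-top n r k σ)
        (trans (total-cong S′ λ {l} {c} _ c∈ → free-place r l (proj₂ c) (ρ k σ) (cells-< c∈))
               (total-words n S′ (suc (ρ k σ))))

    module _ (f s : ℕ) where

      beside : ℕ → K → ℕ × Sgn → ℕ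
      beside e l (d , σ) = adj (suc e) f d (ρ l σ) * adj e s d (ρ l σ)

      -- The pair occupies the levels `suc e` and `e`. Other letters are compared with it through
      -- `beside`, but `f` is compared neither with `s` nor with `r`.
      pairAt : ℕ → ℕ → List K → ℕ → ℕ
      pairAt e n S r = total wt (cells n) S λ l c → free n r l c * beside e l c

      pairAt-top : ∀ e S r → pairAt e (2 + e) S r ≡ words e S (suc s)
      pairAt-top e S r = trans
        (total-vanish (level (suc e) ++ level e) S λ {l} {c} c∈ →
          trans (cong (free (2 + e) r l c *_) (blocked l c∈)) (*-zeroʳ (free (2 + e) r l c)))
        (trans (total-cong S λ {l} {c} _ c∈ → clear l (proj₂ c) (cells-< c∈)) (total-words e S (suc s)))
        where
        blocked : ∀ l {c} → c ∈ level (suc e) ++ level e → beside e l c ≡ 0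
        blocked l (here refl)         = cong (_* adj e s (suc e) (ρ l pos)) (adj-same (suc e) f (ρ l pos))
        blocked l (there (here refl)) = cong (_* adj e s (suc e) (ρ l neg)) (adj-same (suc e) f (ρ l neg))
        blocked l (there (there (here refl))) =
          trans (cong (adj (suc e) f e (ρ l pos) *_) (adj-same e s (ρ l pos))) (*-zeroʳ (adj (suc e) f e (ρ l pos)))
        blocked l (there (there (there (here refl)))) =
          trans (cong (adj (suc e) f e (ρ l neg) *_) (adj-same e s (ρ l neg))) (*-zeroʳ (adj (suc e) f e (ρ l neg)))
        clear : ∀ {d} l σ → d < e → free (2 + e) r l (d , σ) * beside e l (d , σ) ≡ free e (suc s) l (d , σ)
        clear {d} l σ d<e = cong₂ _*_ (free-below r l σ (m<n⇒m<1+n d<e))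
          (trans (cong₂ _*_ (adj-far f (ρ l σ) (s≤s d<e)) (adj-top s (ρ l σ) d<e)) (*-identityˡ _))

      pairAt-step : ∀ e n S r → suc e < n → pairAt e (suc n) S r ≡ pairAt e n S 0 +
        pickSum S λ k S′ → ∑± λ σ → le r (ρ k σ) * adj (suc e) f n (ρ k σ) * pairAt e n S′ (suc (ρ k σ))
      pairAt-step e n S r e<n = trans
        (total-decompose wt-sym (level n) (λ {k} {v} {l} {v′} → level-excl n {k} {v} {l} {v′}) S _)
        (cong₂ _+_
          (total-cong S λ {l} {c} _ c∈ → cong (_* beside e l c) (free-skip r l (proj₂ c) (cells-< c∈)))
          (pickSum-cong S λ k S′ _ → cong₂ _+_ (term k S′ pos) (trans (+-identityʳ _) (term k S′ neg))))
        where
        allowed-high : ∀ {n} x → 0 < n → allowed a n x ≡ 1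
        allowed-high {suc n} x _ = refl
        unary : ∀ k σ → free (suc n) r k (n , σ) * beside e k (n , σ) ≡ le r (ρ k σ) * adj (suc e) f n (ρ k σ)
        unary k σ = cong₂ _*_
          (trans (free-top n r k σ) (trans (cong (le r (ρ k σ) *_) (allowed-high (ρ k σ) (≤-trans (s≤s z≤n) e<n)))
              (*-identityʳ (le r (ρ k σ)))))
          (trans (cong (adj (suc e) f n (ρ k σ) *_) (trans (adj-sym e s n (ρ k σ)) (adj-far (ρ k σ) s e<n)))
              (*-identityʳ (adj (suc e) f n (ρ k σ))))
        term : ∀ k S′ σ →
          free (suc n) r k (n , σ) * beside e k (n , σ) *
            total wt (cells n) S′ (λ l c → free (suc n) r l c * beside e l c * wt k (n , σ) l c) ≡
          le r (ρ k σ) * adj (suc e) f n (ρ k σ) * pairAt e n S′ (suc (ρ k σ))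
        term k S′ σ = cong₂ _*_ (unary k σ) (total-cong S′ λ {l} {c} _ c∈ →
          trans (swap-middle (free (suc n) r l c) (beside e l c) (wt k (n , σ) l c))
            (cong (_* beside e l c) (free-place r l (proj₂ c) (ρ k σ) (cells-< c∈))))

      module _ (s<a : s < a) where

        open Words.Pairs ρ ρ-distinct a f s s<a using (pairWords)

        -- The topmost position of the pair is kept apart because only there does `pairWords`
        -- compare `f` with `r`, a test absent from `pairAt`.
        pairWords-pairAt : ∀ n S r →
          pairWords n S r ≡ le r f * words n S (suc s) + ∑ (downFrom n) λ e → pairAt e (2 + n) S r
        pairWords-pairAt zero    S r = sym (+-identityʳ _)
        pairWords-pairAt (suc n) S r = cong (le r f * words (suc n) S (suc s) +_) (sym (begin
          ∑ (downFrom (suc n)) (λ e → pairAt e (3 + n) S r)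
            ≡⟨ ∑-cong (downFrom (suc n)) (λ {e} e∈ → pairAt-step e (2 + n) S r (s≤s (downFrom-< e∈))) ⟩
          ∑ (downFrom (suc n)) (λ e → pairAt e (2 + n) S 0 + pickSum S (λ k S′ → ∑± (term e k S′)))
            ≡⟨ ∑-+ (downFrom (suc n)) {λ e → pairAt e (2 + n) S 0} ⟩
          ∑ (downFrom (suc n)) (λ e → pairAt e (2 + n) S 0) + ∑ (downFrom (suc n))
              (λ e → pickSum S λ k S′ → ∑± (term e k S′))
            ≡⟨ cong₂ _+_ (all 0 S refl) (trans (∑-pickSum (downFrom (suc n)) S)
                 (pickSum-cong S λ k S′ _ → trans (∑-+ (downFrom (suc n)) {λ e → term e k S′ pos})
                     (∑±-cong (place k S′)))) ⟩
          pairWords n S 0 + pickSum S (λ k S′ → ∑± λ σ → le r (ρ k σ) * pairWords n S′ (suc (ρ k σ))) ∎))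
          where
          term : ℕ → K → List K → Sgn → ℕ
          term e k S′ σ = le r (ρ k σ) * adj (suc e) f (2 + n) (ρ k σ) * pairAt e (2 + n) S′ (suc (ρ k σ))
          downFrom-< : ∀ {n e} → e ∈ downFrom n → e < n
          downFrom-< {suc n} (here refl) = n<1+n n
          downFrom-< {suc n} (there e∈)  = m<n⇒m<1+n (downFrom-< e∈)
          all : ∀ r S → le r f ≡ 1 → ∑ (downFrom (suc n)) (λ e → pairAt e (2 + n) S r) ≡ pairWords n S r
          all r S r≤f = trans
            (cong (_+ ∑ (downFrom n) λ e → pairAt e (2 + n) S r)
              (trans (pairAt-top n S r) (sym (trans (cong (_* words n S (suc s)) r≤f)
                  (*-identityˡ (words n S (suc s)))))))
            (sym (pairWords-pairAt n S r))
          place : ∀ k S′ σ → ∑ (downFrom (suc n)) (λ e → term e k S′ σ) ≡ le r (ρ k σ) * pairWords n S′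
              (suc (ρ k σ))
          place k S′ σ = trans
            (cong₂ _+_
              (trans (cong₂ (λ x y → le r (ρ k σ) * x * y) (trans (adj-sym (suc n) f (2 + n) (ρ k σ))
                  (adj-next n (ρ k σ) f)) (pairAt-top n S′ (suc (ρ k σ))))
                     (*-assoc (le r (ρ k σ)) _ _))
              (trans (∑-cong (downFrom n) λ {e} e∈ → cong (_* pairAt e (2 + n) S′ (suc (ρ k σ)))
                       (trans (cong (le r (ρ k σ) *_) (trans (adj-sym (suc e) f (2 + n) (ρ k σ))
                           (adj-far (ρ k σ) f (s≤s (s≤s (downFrom-< e∈))))))
                              (*-identityʳ (le r (ρ k σ)))))
                     (sym (∑-* (downFrom n) (le r (ρ k σ))))))
            (trans (sym (*-distribˡ-+ (le r (ρ k σ)) _ _))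
              (cong (le r (ρ k σ) *_) (sym (pairWords-pairAt n S′ (suc (ρ k σ))))))

        pairAt-sum : ∀ n S r → r ≤ f → ∑ (downFrom (suc n)) (λ e → pairAt e (2 + n) S r) ≡ pairWords n S r
        pairAt-sum n S r r≤f = trans
          (cong (_+ ∑ (downFrom n) λ e → pairAt e (2 + n) S r)
            (trans (pairAt-top n S r) (sym (trans (cong (_* words n S (suc s)) (le-yes r≤f))
                (*-identityˡ (words n S (suc s)))))))
          (sym (pairWords-pairAt n S r))

      -- With the pair on the last two levels, its first letter bounds the last block of the remaining word.
      pairAt-bottom : ∀ n S r → pairAt 0 (2 + n) S r ≡ Words.words ρ ρ-distinct f n S r
      pairAt-bottom zero    []      r = refl
      pairAt-bottom zero    (k ∷ S) r = trans (pairAt-top 0 (k ∷ S) r) refl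
      pairAt-bottom (suc n) S       r = trans (pairAt-step 0 (2 + n) S r (s≤s (s≤s z≤n)))
        (cong₂ _+_ (pairAt-bottom n S 0) (pickSum-cong S λ k S′ _ → ∑±-cong λ σ →
          cong₂ (λ x y → le r (ρ k σ) * x * y) (same n (ρ k σ)) (pairAt-bottom n S′ (suc (ρ k σ)))))
        where
        same : ∀ n x → adj 1 f (2 + n) x ≡ allowed f n x
        same zero    x = refl
        same (suc n) x = refl

-- The points of the restriction as assignments of residues to coordinates

length-filter : ∀ {P : A → Set} (P? : ∀ x → Dec (P x)) xs → length (filter P? xs) ≡ ∑ xs λ x → ind (P? x)
length-filter P? []       = refl
length-filter P? (x ∷ xs) with P? x
... | yes _ = cong suc (length-filter P? xs)
... | no  _ = length-filter P? xs

∑-map : ∀ (f : A → B) xs {h} → ∑ (map f xs) h ≡ ∑ xs (h ∘ f)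
∑-map f []           = refl
∑-map f (x ∷ xs) {h} = cong (λ z → h (f x) + z) (∑-map f xs)

∑-concatMap : ∀ (f : A → List B) xs {h} → ∑ (concatMap f xs) h ≡ ∑ xs λ x → ∑ (f x) h
∑-concatMap f []       = refl
∑-concatMap f (x ∷ xs) = trans (∑-++ (f x) _) (cong (λ z → ∑ (f x) _ + z) (∑-concatMap f xs))

∑-allFin : ∀ q {h} → ∑ (allFin q) (h ∘ toℕ) ≡ ∑ (upTo q) h
∑-allFin q {h} = reindex q id id λ _ → refl
  where
  reindex : ∀ n (f : Fin n → A) (f′ : ℕ → B) {h : A → ℕ} {h′ : B → ℕ} →
            (∀ k → h (f k) ≡ h′ (f′ (toℕ k))) → ∑ (tabulate f) h ≡ ∑ (applyUpTo f′ n) h′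
  reindex zero    f f′ e = refl
  reindex (suc n) f f′ e = cong₂ _+_ (e Fin.zero) (reindex n (f ∘ Fin.suc) (f′ ∘ suc) (e ∘ Fin.suc))

module _ {q : ℕ} (w : L → ℕ → L → ℕ → ℕ) where

  -- The term of `total` that belongs to a single point.
  weight : ∀ {m} → (Fin m → L) → Vec (Fin q) m → (L → ℕ → ℕ) → ℕ
  weight lab []      u = 1
  weight lab (v ∷ x) u =
    u (lab Fin.zero) (toℕ v) * weight (lab ∘ Fin.suc) x λ l v′ → u l v′ * w (lab Fin.zero) (toℕ v) l v′

  ∑-weight : ∀ m (lab : Fin m → L) u →
             ∑ (allPoints q m) (λ x → weight lab x u) ≡ total w (upTo q) (tabulate lab) u
  ∑-weight zero    lab u = refl
  ∑-weight (suc m) lab u = trans (∑-concatMap (λ v → map (v ∷_) (allPoints q m)) (allFin q))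
    (trans (∑-cong (allFin q) λ {v} _ → trans (∑-map (v ∷_) (allPoints q m))
        (trans (sym (∑-* (allPoints q m) (u (lab Fin.zero) (toℕ v))))
          (cong (u (lab Fin.zero) (toℕ v) *_) (∑-weight m (lab ∘ Fin.suc) _))))
      (∑-allFin q))

  weight-one : ∀ {m} (lab : Fin m → L) x u →
    (∀ s → u (lab s) (toℕ (lookup x s)) ≡ 1) →
    (∀ {s t} → s Fin.< t → w (lab s) (toℕ (lookup x s)) (lab t) (toℕ (lookup x t)) ≡ 1) →
    weight lab x u ≡ 1
  weight-one lab []      u hu hw = refl
  weight-one lab (v ∷ x) u hu hw = cong₂ _*_ (hu Fin.zero)
    (weight-one (lab ∘ Fin.suc) x _ (λ s → cong₂ _*_ (hu (Fin.suc s)) (hw (s≤s z≤n))) (hw ∘ s≤s))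

  weight-nonzero : ∀ {m} (lab : Fin m → L) x u → weight lab x u ≢ 0 →
    (∀ s → u (lab s) (toℕ (lookup x s)) ≢ 0) ×
    (∀ {s t} → s Fin.< t → w (lab s) (toℕ (lookup x s)) (lab t) (toℕ (lookup x t)) ≢ 0)
  weight-nonzero lab []      u W≢0 = (λ ()) , λ {s} → contradiction s λ ()
  weight-nonzero lab (v ∷ x) u W≢0 =
    (λ { Fin.zero → λ e → W≢0 (cong (_* rest) e)
       ; (Fin.suc s) → λ e → proj₁ later s (zero⇒product-zero _ e) }) ,
    λ { {Fin.zero}  {Fin.suc t} _         e → proj₁ later t (trans (cong (u (lab (Fin.suc t)) _ *_) e)
        (*-zeroʳ (u (lab (Fin.suc t)) _)))
      ; {Fin.suc s} {Fin.suc t} (s≤s s<t) e → proj₂ later s<t e }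
    where
    rest = weight (lab ∘ Fin.suc) x λ l v′ → u l v′ * w (lab Fin.zero) (toℕ v) l v′
    later = weight-nonzero (lab ∘ Fin.suc) x _ λ e → W≢0 (trans (cong (u (lab Fin.zero) (toℕ v) *_) e)
        (*-zeroʳ (u (lab Fin.zero) (toℕ v))))

-- Hyperplanes modulo q

divides-distance : ∀ q {a b} → a ≡ b ⊎ a ≡ b + q → q ∣ ∣ a ⊖ b ∣
divides-distance q {a} (inj₁ refl) = subst (q ∣_) (sym (cong ∣_∣ (ℤP.n⊖n≡0 a))) (q ∣0)
divides-distance q {_} {b} (inj₂ refl) = subst (q ∣_)
  (sym (cong ∣_∣ (trans (ℤP.⊖-≥ (m≤m+n b q)) (cong ℤ.+_ (m+n∸m≡n b q))))) ∣-refl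

-- The bounds say that `a - b` lies strictly between `-q` and `2q`, where 0 and `q` are the only
-- multiples of `q`.
distance-divides : ∀ q .{{_ : NonZero q}} {a b} → a < b + (q + q) → b < a + q → q ∣ ∣ a ⊖ b ∣ → a ≡ b ⊎ a ≡ b + q
distance-divides q {a} {b} a< b< q∣ with ≤-total a b
... | inj₁ a≤b = inj₁ (≤-antisym a≤b (m∸n≡0⇒m≤n zero-diff))
  where
  q∣b∸a : q ∣ b ∸ a
  q∣b∸a = subst (q ∣_) (ℤP.∣⊖∣-≤ a≤b) q∣
  zero-diff : b ∸ a ≡ 0
  zero-diff with b ∸ a in eq
  ... | zero  = refl
  ... | suc k = contradiction (subst (q ∣_) eq q∣b∸a)
                  (>⇒∤ (subst (_< q) eq (+-cancelˡ-< a _ _ (subst (_< a + q) (sym (m+[n∸m]≡n a≤b)) b<))))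
... | inj₂ b≤a with subst (q ∣_) (cong ∣_∣ (ℤP.⊖-≥ b≤a)) q∣
...   | divides zero          e = inj₁ (≤-antisym (m∸n≡0⇒m≤n e) b≤a)
...   | divides (suc zero)    e = inj₂ (trans (sym (m+[n∸m]≡n b≤a)) (cong (λ z → b + z) (trans e (+-identityʳ q))))
...   | divides (suc (suc c)) e = contradiction (+-cancelˡ-< b _ _
    (subst (_< b + (q + q)) (sym (trans (cong (λ z → b + z) (sym e)) (m+[n∸m]≡n b≤a))) a<))
                                    (≤⇒≯ (≤-trans (m≤m+n (q + q) (c * q)) (≤-reflexive (+-assoc q q (c * q)))))

module _ {m : ℕ} where

  -- The right-hand side is the indicator inside `e`; matching on the comparison of `k` and `s`
  -- together with this equation evaluates it.
  lookup-e : ∀ (s k : Fin m) → lookup (e s) k ≡ _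
  lookup-e s k = lookup∘tabulate _ k

  lookup-e-same : ∀ (s : Fin m) → lookup (e s) s ≡ ℤ.+ 1
  lookup-e-same s with s Fin.≟ s | lookup-e s s
  ... | yes _ | eq = eq
  ... | no ne | _  = contradiction refl ne

  lookup-e-other : ∀ {s k : Fin m} → k ≢ s → lookup (e s) k ≡ ℤ.+ 0
  lookup-e-other {s} {k} ne with k Fin.≟ s | lookup-e s k
  ... | yes k≡s | _  = contradiction k≡s ne
  ... | no _    | eq = eq

lhs-select : ∀ {q m} (a : Vec ℤ m) (x : Vec (Fin q) m) s →
  lookup a s ≡ ℤ.+ 1 → (∀ k → k ≢ s → lookup a k ≡ ℤ.+ 0) → lhs a x ≡ ℤ.+ toℕ (lookup x s)
lhs-select (a ∷ as) (v ∷ x) Fin.zero    one zeros rewrite one =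
  trans (cong₂ ℤ._+_ (ℤP.*-identityˡ (ℤ.+ toℕ v)) (vanish as x λ k → zeros (Fin.suc k) λ ())) (ℤP.+-identityʳ _)
  where
  vanish : ∀ {q m} (a : Vec ℤ m) (x : Vec (Fin q) m) → (∀ k → lookup a k ≡ ℤ.+ 0) → lhs a x ≡ ℤ.+ 0
  vanish []       []      _ = refl
  vanish (a ∷ as) (v ∷ x) h rewrite h Fin.zero = trans (ℤP.+-identityˡ _) (vanish as x (h ∘ Fin.suc))
lhs-select (a ∷ as) (v ∷ x) (Fin.suc s) one zeros rewrite zeros Fin.zero (λ ()) =
  trans (ℤP.+-identityˡ _) (lhs-select as x s one λ k k≢s → zeros (Fin.suc k) (k≢s ∘ FinP.suc-injective))

lhs-e : ∀ {q m} (x : Vec (Fin q) m) s → lhs (e s) x ≡ ℤ.+ toℕ (lookup x s)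
lhs-e x s = lhs-select (e s) x s (lookup-e-same s) λ k → lookup-e-other

lhs-+ : ∀ {q m} (a b : Vec ℤ m) (x : Vec (Fin q) m) →
        lhs (Vec.zipWith ℤ._+_ a b) x ≡ lhs a x ℤ.+ lhs b x
lhs-+ []       []       []      = refl
lhs-+ (a ∷ as) (b ∷ bs) (v ∷ x) =
  trans (cong (λ z → (a ℤ.+ b) ℤ.* ℤ.+ toℕ v ℤ.+ z) (lhs-+ as bs x)) (lem a b (ℤ.+ toℕ v) _ _)
  where
  lem : ∀ a b v y z → (a ℤ.+ b) ℤ.* v ℤ.+ (y ℤ.+ z) ≡ (a ℤ.* v ℤ.+ y) ℤ.+ (b ℤ.* v ℤ.+ z)
  lem = ℤSolver.solve-∀

lhs-- : ∀ {q m} (a b : Vec ℤ m) (x : Vec (Fin q) m) →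
        lhs (Vec.zipWith ℤ._-_ a b) x ≡ lhs a x ℤ.- lhs b x
lhs-- []       []       []      = refl
lhs-- (a ∷ as) (b ∷ bs) (v ∷ x) =
  trans (cong (λ z → (a ℤ.- b) ℤ.* ℤ.+ toℕ v ℤ.+ z) (lhs-- as bs x)) (lem a b (ℤ.+ toℕ v) _ _)
  where
  lem : ∀ a b v y z → (a ℤ.- b) ℤ.* v ℤ.+ (y ℤ.- z) ≡ (a ℤ.* v ℤ.+ y) ℤ.- (b ℤ.* v ℤ.+ z)
  lem = ℤSolver.solve-∀

module _ {q m : ℕ} (x : Vec (Fin q) m) where

  val : Fin m → ℕ
  val s = toℕ (lookup x s)

  hCoord-⊖ : ∀ s b → lhs (coeffs (hCoord s (ℤ.+ b))) x ℤ.- ℤ.+ b ≡ val s ⊖ b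
  hCoord-⊖ s b = trans (cong (ℤ._- ℤ.+ b) (lhs-e x s)) (ℤP.m-n≡m⊖n (val s) b)

  hPlus-⊖ : ∀ s t b → lhs (coeffs (hPlus s t (ℤ.+ b))) x ℤ.- ℤ.+ b ≡ (val s + val t) ⊖ b
  hPlus-⊖ s t b = trans
    (cong (ℤ._- ℤ.+ b) (trans (lhs-+ (e s) (e t) x) (cong₂ ℤ._+_ (lhs-e x s) (lhs-e x t))))
    (ℤP.m-n≡m⊖n (val s + val t) b)

  hMinus-⊖ : ∀ s t b → lhs (coeffs (hMinus s t (ℤ.+ b))) x ℤ.- ℤ.+ b ≡ val s ⊖ (val t + b)
  hMinus-⊖ s t b = trans
    (cong (ℤ._- ℤ.+ b) (trans (lhs-- (e s) (e t) x) (cong₂ ℤ._-_ (lhs-e x s) (lhs-e x t))))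
    (trans (lem (ℤ.+ val s) (ℤ.+ val t) (ℤ.+ b)) (ℤP.m-n≡m⊖n (val s) (val t + b)))
    where
    lem : ∀ a b c → a ℤ.- b ℤ.- c ≡ a ℤ.- (b ℤ.+ c)
    lem = ℤSolver.solve-∀

-- Distinctness of the hyperplanes

module _ {m : ℕ} {i j : Fin m} (i<j : i Fin.< j) where

  private
    i≢j : i ≢ j
    i≢j refl = <-irrefl refl i<j

    at-i : lookup (coeffs (hPlus i j (ℤ.+ 1))) i ≡ ℤ.+ 1
    at-i = trans (lookup-zipWith ℤ._+_ i (e i) (e j)) (cong₂ ℤ._+_ (lookup-e-same i) (lookup-e-other i≢j))

    at-j : lookup (coeffs (hPlus i j (ℤ.+ 1))) j ≡ ℤ.+ 1
    at-j = trans (lookup-zipWith ℤ._+_ j (e i) (e j)) (cong₂ ℤ._+_ (lookup-e-other (i≢j ∘ sym)) (lookup-e-same j))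

    e-is-one : ∀ {s k : Fin m} → lookup (e s) k ≡ ℤ.+ 1 → k ≡ s
    e-is-one {s} {k} eq with k Fin.≟ s
    ... | yes k≡s = k≡s
    ... | no  k≢s = contradiction (trans (sym eq) (lookup-e-other k≢s)) λ ()

    e+e-is-one : ∀ {s t k : Fin m} → lookup (coeffs (hPlus s t (ℤ.+ 1))) k ≡ ℤ.+ 1 → k ≡ s ⊎ k ≡ t
    e+e-is-one {s} {t} {k} eq with k Fin.≟ s | k Fin.≟ t
    ... | yes k≡s | _       = inj₁ k≡s
    ... | no  _   | yes k≡t = inj₂ k≡t
    ... | no  k≢s | no  k≢t = contradiction
          (trans (sym eq) (trans (lookup-zipWith ℤ._+_ k (e s) (e t))
              (cong₂ ℤ._+_ (lookup-e-other k≢s) (lookup-e-other k≢t)))) λ ()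

    e-e-is-one : ∀ {s t k : Fin m} → lookup (coeffs (hMinus s t (ℤ.+ 1))) k ≡ ℤ.+ 1 → k ≡ s
    e-e-is-one {s} {t} {k} eq with k Fin.≟ s
    ... | yes k≡s = k≡s
    ... | no  k≢s = contradiction (trans (sym eq) (trans (lookup-zipWith ℤ._-_ k (e s) (e t))
        (cong (ℤ._- lookup (e t) k) (lookup-e-other k≢s)))) not-one
      where
      not-one : ¬ (ℤ.+ 1 ≡ ℤ.+ 0 ℤ.- lookup (e t) k)
      not-one with k Fin.≟ t
      ... | yes refl rewrite lookup-e-same t = λ ()
      ... | no  k≢t rewrite lookup-e-other k≢t = λ ()

  -- The normal vector of `hPlus i j` has the entry 1 at two places, that of `hCoord` or `hMinus` at
  -- no more than one.
  hCoord≢hPlus : ∀ s b → hCoord s b ≢ hPlus i j (ℤ.+ 1)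
  hCoord≢hPlus s b eq = i≢j (trans (e-is-one (here-one at-i)) (sym (e-is-one (here-one at-j))))
    where
    here-one : ∀ {k} → lookup (coeffs (hPlus i j (ℤ.+ 1))) k ≡ ℤ.+ 1 → lookup (e s) k ≡ ℤ.+ 1
    here-one {k} = trans (cong (λ H → lookup (coeffs H) k) eq)

  hMinus≢hPlus : ∀ s t b → hMinus s t b ≢ hPlus i j (ℤ.+ 1)
  hMinus≢hPlus s t b eq = i≢j (trans (e-e-is-one {s} {t} (here-one at-i))
      (sym (e-e-is-one {s} {t} (here-one at-j))))
    where
    here-one : ∀ {k} → lookup (coeffs (hPlus i j (ℤ.+ 1))) k ≡ ℤ.+ 1 → lookup (coeffs (hMinus s t b)) k ≡ ℤ.+ 1
    here-one {k} = trans (cong (λ H → lookup (coeffs H) k) eq)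

  hPlus-injective : ∀ {s t} → s Fin.< t → hPlus s t (ℤ.+ 1) ≡ hPlus i j (ℤ.+ 1) → s ≡ i × t ≡ j
  hPlus-injective {s} {t} s<t eq with e+e-is-one {s} {t} (here-one at-i) | e+e-is-one {s} {t} (here-one at-j)
    where
    here-one : ∀ {k} → lookup (coeffs (hPlus i j (ℤ.+ 1))) k ≡ ℤ.+ 1 → lookup (coeffs (hPlus s t (ℤ.+ 1))) k ≡ ℤ.+ 1
    here-one {k} = trans (cong (λ H → lookup (coeffs H) k) eq)
  ... | inj₁ i≡s | inj₂ j≡t = sym i≡s , sym j≡t
  ... | inj₁ i≡s | inj₁ j≡s = contradiction (trans i≡s (sym j≡s)) i≢j
  ... | inj₂ i≡t | inj₂ j≡t = contradiction (trans i≡t (sym j≡t)) i≢j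
  ... | inj₂ refl | inj₁ refl = contradiction s<t (<-asym i<j)

-- The arrangement in terms of residues

module Residues {m : ℕ} (q : ℕ) {i j : Fin m} (i<j : i Fin.< j) where

  exempt? : (s t : Fin m) → Dec (s ≡ i × t ≡ j)
  exempt? s t = (s Fin.≟ i) ×-dec (t Fin.≟ j)

  SumOK : Fin m → Fin m → ℕ → ℕ → Set
  SumOK s t v v′ = (s ≡ i × t ≡ j → v + v′ ≡ suc q) × (¬ (s ≡ i × t ≡ j) → v + v′ ≢ suc q)

  sumOK? : ∀ s t v v′ → Dec (SumOK s t v v′)
  sumOK? s t v v′ with exempt? s t | v + v′ ≟ suc q
  ... | yes ex | yes eq = yes ((λ _ → eq) , λ ¬ex → contradiction ex ¬ex)
  ... | yes ex | no  ne = no λ ok → ne (proj₁ ok ex)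
  ... | no ¬ex | yes eq = no λ ok → proj₂ ok ¬ex eq
  ... | no ¬ex | no  ne = yes ((λ ex → contradiction ex ¬ex) , λ _ → ne)

  -- For representatives from 2 to `q - 1` each of the four congruences has a single integer form:
  -- the sum can only be `q` or `q + 1`, and the difference only 0 or 1.
  Compatible : Fin m → Fin m → ℕ → ℕ → Set
  Compatible s t v v′ = v ≢ v′ × v + v′ ≢ q × v ≢ suc v′ × SumOK s t v v′

  compatible? : ∀ s t v v′ → Dec (Compatible s t v v′)
  compatible? s t v v′ = ¬? (v ≟ v′) ×-dec ¬? (v + v′ ≟ q) ×-dec ¬? (v ≟ suc v′) ×-dec sumOK? s t v v′

  -- The value for equal labels is never used.
  compat : Fin m → ℕ → Fin m → ℕ → ℕ
  compat s v t v′ with FinP.<-cmp s t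
  ... | tri< _ _ _ = ind (compatible? s t v v′)
  ... | tri≈ _ _ _ = 0
  ... | tri> _ _ _ = ind (compatible? t s v′ v)

  compat-< : ∀ {s t} v v′ → s Fin.< t → compat s v t v′ ≡ ind (compatible? s t v v′)
  compat-< {s} {t} v v′ s<t with FinP.<-cmp s t
  ... | tri< _ _ _   = refl
  ... | tri≈ s≮t _ _ = contradiction s<t s≮t
  ... | tri> s≮t _ _ = contradiction s<t s≮t

  compat-> : ∀ {s t} v v′ → t Fin.< s → compat s v t v′ ≡ ind (compatible? t s v′ v)
  compat-> {s} {t} v v′ t<s with FinP.<-cmp s t
  ... | tri< _ _ t≮s = contradiction t<s t≮s
  ... | tri≈ _ _ t≮s = contradiction t<s t≮s
  ... | tri> _ _ _   = refl

  compat-sym : ∀ s v t v′ → compat s v t v′ ≡ compat t v′ s v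
  compat-sym s v t v′ with FinP.<-cmp s t
  ... | tri< s<t _ _ = sym (compat-> v′ v s<t)
  ... | tri> _ _ t<s = sym (compat-< v′ v t<s)
  ... | tri≈ _ refl _ with FinP.<-cmp s s
  ...   | tri< s<s _ _ = contradiction refl (<⇒≢ s<s)
  ...   | tri≈ _ _ _   = refl
  ...   | tri> _ _ s<s = contradiction refl (<⇒≢ s<s)

  nontrivial : ℕ → ℕ
  nontrivial 0             = 0
  nontrivial 1             = 0
  nontrivial (suc (suc _)) = 1

  nontrivial-one : ∀ {v} → 2 ≤ v → nontrivial v ≡ 1
  nontrivial-one (s≤s (s≤s _)) = refl

  nontrivial⇒2≤ : ∀ v → nontrivial v ≢ 0 → 2 ≤ v
  nontrivial⇒2≤ 0             ne = contradiction refl ne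
  nontrivial⇒2≤ 1             ne = contradiction refl ne
  nontrivial⇒2≤ (suc (suc _)) ne = s≤s (s≤s z≤n)

  H : Hyperplane m
  H = hPlus i j (ℤ.+ 1)

  Counted : Vec (Fin q) m → Set
  Counted x = x ∈H H × All (λ H′ → ¬ (x ∈H H′)) (shiBWithout m H)

  Valid : Vec (Fin q) m → Set
  Valid x = (∀ s → 2 ≤ val x s) × (∀ {s t} → s Fin.< t → Compatible s t (val x s) (val x t))

  module _ .{{_ : NonZero q}} where

    counted⇒valid : ∀ x → Counted x → Valid x
    counted⇒valid x (x∈H , avoids) = big , λ {s} {t} s<t →
      (λ eq → off (pair∈ s<t (there (there (here refl)))) (hMinus≢hPlus i<j s t (ℤ.+ 0))
                (subst (λ z → q ∣ ∣ z ∣) (sym (hMinus-⊖ x s t 0))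
                    (divides-distance q (inj₁ (trans eq (sym (+-identityʳ _))))))) ,
      (λ eq → off (pair∈ s<t (here refl)) (λ ())
                (subst (λ z → q ∣ ∣ z ∣) (sym (hPlus-⊖ x s t 0)) (divides-distance q (inj₂ eq)))) ,
      (λ eq → off (pair∈ s<t (there (there (there (here refl))))) (hMinus≢hPlus i<j s t (ℤ.+ 1))
                (subst (λ z → q ∣ ∣ z ∣) (sym (hMinus-⊖ x s t 1))
                    (divides-distance q (inj₁ (trans eq (+-comm 1 _)))))) ,
      (λ { (refl , refl) → on }) ,
      (λ ¬ex eq → off (pair∈ s<t (there (here refl))) (λ same → ¬ex (hPlus-injective i<j s<t same))
                    (subst (λ z → q ∣ ∣ z ∣) (sym (hPlus-⊖ x s t 1)) (divides-distance q (inj₂ eq))))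
      where
      off : ∀ {H′} → H′ ∈ shiB m → H′ ≢ H → ¬ (x ∈H H′)
      off H′∈ H′≢ = All.lookup avoids (∈-filter⁺ (λ H′ → ¬? (H′ ≟H H)) H′∈ H′≢)
      coord∈ : ∀ s {H′} → H′ ∈ hCoord s (ℤ.+ 0) ∷ hCoord s (ℤ.+ 1) ∷ [] → H′ ∈ shiB m
      coord∈ s H′∈ = ∈-++⁺ˡ (∈-concatMap⁺ _ (lose (∈-allFin s) H′∈))
      pair∈ : ∀ {s t H′} → s Fin.< t →
        H′ ∈ hPlus s t (ℤ.+ 0) ∷ hPlus s t (ℤ.+ 1) ∷ hMinus s t (ℤ.+ 0) ∷ hMinus s t (ℤ.+ 1) ∷ [] → H′ ∈ shiB m
      pair∈ {s} {t} s<t H′∈ = ∈-++⁺ʳ (concatMap _ (allFin m)) (∈-concatMap⁺ _ (lose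
        (∈-filter⁺ _ (∈-concatMap⁺ _ (lose (∈-allFin s) (∈-map⁺ (s ,_) (∈-allFin t)))) s<t) H′∈))
      big : ∀ s → 2 ≤ val x s
      big s = ≤∧≢⇒< (n≢0⇒n>0 ≢0) (≢1 ∘ sym)
        where
        ≢0 : val x s ≢ 0
        ≢0 eq = off (coord∈ s (here refl)) (hCoord≢hPlus i<j s (ℤ.+ 0))
          (subst (λ z → q ∣ ∣ z ∣) (sym (hCoord-⊖ x s 0)) (divides-distance q (inj₁ eq)))
        ≢1 : val x s ≢ 1
        ≢1 eq = off (coord∈ s (there (here refl))) (hCoord≢hPlus i<j s (ℤ.+ 1))
          (subst (λ z → q ∣ ∣ z ∣) (sym (hCoord-⊖ x s 1)) (divides-distance q (inj₁ eq)))
      on : val x i + val x j ≡ suc q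
      on with distance-divides q (m<n⇒m<1+n (+-mono-< (FinP.toℕ<n (lookup x i)) (FinP.toℕ<n (lookup x j))))
                (≤-trans (≤-trans (big i) (m≤m+n _ _)) (m≤m+n _ q))
                (subst (λ z → q ∣ ∣ z ∣) (hPlus-⊖ x i j 1) x∈H)
      ... | inj₁ eq = contradiction (subst (2 ≤_) eq (≤-trans (big i) (m≤m+n _ _))) λ { (s≤s ()) }
      ... | inj₂ eq = eq

    valid⇒counted : ∀ x → Valid x → Counted x
    valid⇒counted x (big , ok) =
      subst (λ z → q ∣ ∣ z ∣) (sym (hPlus-⊖ x i j 1)) (divides-distance q
          (inj₂ (proj₁ (proj₂ (proj₂ (proj₂ (ok i<j)))) (refl , refl)))) ,
      All.tabulate λ {H′} H′∈ → avoid (∈-filter⁻ (λ H′ → ¬? (H′ ≟H H)) H′∈)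
      where
      <q : ∀ s → val x s < q
      <q s = FinP.toℕ<n (lookup x s)
      coord : ∀ s b → b < 2 → ¬ (x ∈H hCoord s (ℤ.+ b))
      coord s b b<2 x∈ with distance-divides q (≤-trans (<q s) (≤-trans (m≤m+n q q) (m≤n+m (q + q) b)))
                         (≤-trans b<2 (≤-trans (big s) (m≤m+n _ q))) (subst (λ z → q ∣ ∣ z ∣) (hCoord-⊖ x s b) x∈)
      ... | inj₁ eq = <-irrefl (sym eq) (≤-trans b<2 (big s))
      ... | inj₂ eq = <-irrefl eq (≤-trans (<q s) (m≤n+m q b))
      plus : ∀ s t b → b < 2 → val x s + val x t ≢ b + q → ¬ (x ∈H hPlus s t (ℤ.+ b))
      plus s t b b<2 ne x∈ with distance-divides q (≤-trans (+-mono-< (<q s) (<q t)) (m≤n+m (q + q) b))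
          (≤-trans (≤-trans b<2 (≤-trans (big s) (m≤m+n _ _))) (m≤m+n _ q))
              (subst (λ z → q ∣ ∣ z ∣) (hPlus-⊖ x s t b) x∈)
      ... | inj₁ eq = <-irrefl (sym eq) (≤-trans b<2 (≤-trans (big s) (m≤m+n _ _)))
      ... | inj₂ eq = ne eq
      minus : ∀ s t b → b < 2 → val x s ≢ val x t + b → ¬ (x ∈H hMinus s t (ℤ.+ b))
      minus s t b b<2 ne x∈ with distance-divides q
          (≤-trans (<q s) (≤-trans (m≤m+n q q) (m≤n+m (q + q) (val x t + b))))
          (subst₂ _<_ (+-comm b _) refl (+-mono-<-≤ (≤-trans b<2 (big s)) (<⇒≤ (<q t))))
              (subst (λ z → q ∣ ∣ z ∣) (hMinus-⊖ x s t b) x∈)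
      ... | inj₁ eq = ne eq
      ... | inj₂ eq = <-irrefl eq (≤-trans (<q s) (m≤n+m q (val x t + b)))
      avoid : ∀ {H′} → H′ ∈ shiB m × H′ ≢ H → ¬ (x ∈H H′)
      avoid (H′∈ , H′≢) with ∈-++⁻ (concatMap (λ s → hCoord s (ℤ.+ 0) ∷ hCoord s (ℤ.+ 1) ∷ []) (allFin m)) H′∈
      ... | inj₁ c∈ with find (∈-concatMap⁻ (λ s → hCoord s (ℤ.+ 0) ∷ hCoord s (ℤ.+ 1) ∷ []) {xs = allFin m} c∈)
      ...   | s , _ , here refl         = coord s 0 (s≤s z≤n)
      ...   | s , _ , there (here refl) = coord s 1 ≤-refl
      avoid (H′∈ , H′≢) | inj₂ p∈ with find (∈-concatMap⁻ _ {xs = pairs m} p∈)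
      ...   | (s , t) , st∈ , H′∈st with proj₂ (∈-filter⁻ (λ p → proj₁ p FinP.<? proj₂ p)
          {xs = concatMap (λ s → map (s ,_) (allFin m)) (allFin m)} st∈) | H′∈st
      ...     | s<t | here refl = plus s t 0 (s≤s z≤n) (proj₁ (proj₂ (ok s<t)))
      ...     | s<t | there (here refl) = plus s t 1 ≤-refl (proj₂ (proj₂ (proj₂ (proj₂ (ok s<t))))
          λ { (refl , refl) → H′≢ refl })
      ...     | s<t | there (there (here refl)) = minus s t 0 (s≤s z≤n) λ eq → proj₁ (ok s<t)
          (trans eq (+-identityʳ _))
      ...     | s<t | there (there (there (here refl))) = minus s t 1 ≤-refl λ eq → proj₁ (proj₂ (proj₂ (ok s<t)))
          (trans eq (+-comm _ 1))

    charQP-total : charQP m q H ≡ total compat (upTo q) (allFin m) λ _ → nontrivial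
    charQP-total = trans (length-filter _ (allPoints q m))
      (trans (∑-cong (allPoints q m) λ {x} _ → pointwise x ((x ∈H? H) ×-dec All.all? (λ H′ → ¬? (x ∈H? H′))
          (shiBWithout m H)))
        (∑-weight compat m id λ _ → nontrivial))
      where
      ind-nonzero : ∀ {P : Set} (p : Dec P) → ind p ≢ 0 → P
      ind-nonzero (yes p) _  = p
      ind-nonzero (no _)  ne = contradiction refl ne
      pointwise : ∀ x (p : Dec (Counted x)) → ind p ≡ weight compat id x λ _ → nontrivial
      pointwise x (yes c) with counted⇒valid x c
      ... | big , ok = sym (weight-one compat id x _ (nontrivial-one ∘ big)
              λ {s} {t} s<t → trans (compat-< (val x s) (val x t) s<t)
                  (ind-yes (compatible? s t (val x s) (val x t)) (ok s<t)))
      pointwise x (no ¬c) with weight compat id x (λ _ → nontrivial) ≟ 0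
      ... | yes W≡0 = sym W≡0
      ... | no  W≢0 with weight-nonzero compat id x _ W≢0
      ...   | u≢0 , w≢0 = contradiction (valid⇒counted x
                ( (λ s → nontrivial⇒2≤ (val x s) (u≢0 s))
                , λ {s} {t} s<t → ind-nonzero (compatible? s t (val x s) (val x t))
                    (w≢0 s<t ∘ trans (compat-< (val x s) (val x t) s<t)))) ¬c

-- Signed coordinates as letters

-- Positive letters have the ranks below `m`, negative ones those from `m` to `2m - 1` in reverse
-- order, so `m` as start rank or as bound separates the signs.
rank : ∀ {m} → Fin m → Sgn → ℕ
rank     k pos = toℕ k
rank {m} k neg = m + (m ∸ suc (toℕ k))

module _ {m : ℕ} where

  rank-pos-< : ∀ (k : Fin m) → rank k pos < m
  rank-pos-< = FinP.toℕ<n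

  rank-neg-≥ : ∀ (k : Fin m) → m ≤ rank k neg
  rank-neg-≥ k = m≤m+n m _

  rank-pos-neg : ∀ (k l : Fin m) → rank k pos < rank l neg
  rank-pos-neg k l = <-≤-trans (rank-pos-< k) (rank-neg-≥ l)

  rank-neg-anti : ∀ {k l : Fin m} → k Fin.< l → rank l neg < rank k neg
  rank-neg-anti {k} {l} k<l = +-monoʳ-< m (∸-monoʳ-< (s≤s k<l) (FinP.toℕ<n l))

  rank-neg-< : ∀ (k : Fin m) → rank k neg < m + m
  rank-neg-< k = +-monoʳ-< m (∸-monoʳ-< {m} {suc (toℕ k)} {0} (s≤s z≤n) (FinP.toℕ<n k))

  rank-distinct : ∀ {k l : Fin m} → k ≢ l → ∀ σ τ → rank k σ ≢ rank l τ
  rank-distinct k≢l pos pos eq = k≢l (FinP.toℕ-injective eq)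
  rank-distinct {k} {l} k≢l pos neg eq = <⇒≢ (rank-pos-neg k l) eq
  rank-distinct {k} {l} k≢l neg pos eq = >⇒≢ (rank-pos-neg l k) eq
  rank-distinct {k} {l} k≢l neg neg eq with FinP.<-cmp k l
  ... | tri< k<l _ _ = >⇒≢ (rank-neg-anti k<l) eq
  ... | tri≈ _ k≡l _ = k≢l k≡l
  ... | tri> _ _ l<k = <⇒≢ (rank-neg-anti l<k) eq

-- Residues as cells

-- Turns a polynomial identity that exhibits the difference into a strict inequality.
excess : ∀ {x y} k → x ≡ suc (y + k) → y < x
excess {y = y} k refl = s≤s (m≤m+n y k)

-- The modulus is q = 2 n₀ + 2 + b, with b = 1 if q is odd and b = 0 if q is even.  The cell (d , pos)
-- is the residue n₀ + 1 − d and (d , neg) is its negative; for even q these coincide at d = 0,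
-- where only the positive one is live.
modulus : ℕ → ℕ → ℕ
modulus n₀ b = suc n₀ + suc (n₀ + b)

value : ℕ → ℕ → ℕ × Sgn → ℕ
value n₀ b (d , pos) = suc n₀ ∸ d
value n₀ b (d , neg) = suc (n₀ + b) + d

nonzero : ℕ → ℕ
nonzero zero    = 0
nonzero (suc _) = 1

live : ℕ → ℕ × Sgn → ℕ
live b (d , pos) = 1
live b (d , neg) = nonzero (b + d)

live-neg : ∀ b {d} → live b (d , neg) ≢ 0 → ∃ λ r → b + d ≡ suc r
live-neg b {d} ne with b + d
... | zero  = contradiction refl ne
... | suc r = r , refl

value-pos : ∀ {n₀} b d p → n₀ ≡ d + p → value n₀ b (d , pos) ≡ suc p
value-pos b d p eq = trans (cong (λ z → suc z ∸ d) eq) (trans (cong (_∸ d) (sym (+-suc d p))) (m+n∸m≡n d (suc p)))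

∑-first : ∀ n {h : ℕ → ℕ} → ∑ (downFrom (suc n)) h ≡ ∑ (downFrom n) (h ∘ suc) + h 0
∑-first zero    {h} = +-comm (h 0) 0
∑-first (suc n) {h} = trans (cong (h (suc n) +_) (∑-first n)) (sym (+-assoc (h (suc n)) _ _))

∑-reverse : ∀ n {h : ℕ → ℕ} → ∑ (downFrom n) (λ d → h (n ∸ d)) ≡ ∑ (downFrom n) (h ∘ suc)
∑-reverse zero        = refl
∑-reverse (suc n) {h} = trans (∑-first n) (trans (+-comm _ (h (suc n))) (cong (h (suc n) +_) (∑-reverse n {h})))

∑-split : ∀ k n {h : ℕ → ℕ} → ∑ (downFrom (n + k)) h ≡ ∑ (downFrom n) (λ d → h (k + d)) + ∑ (downFrom k) h
∑-split k zero        = refl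
∑-split k (suc n) {h} = trans (cong₂ (λ x y → h x + y) (+-comm n k) (∑-split k n)) (sym (+-assoc (h (k + n)) _ _))

∑-upTo : ∀ n {h : ℕ → ℕ} → ∑ (upTo n) h ≡ ∑ (downFrom n) h
∑-upTo zero        = refl
∑-upTo (suc n) {h} = trans (cong (λ xs → ∑ xs h) (sym (upTo-∷ʳ n)))
  (trans (∑-++ (upTo n) _) (trans (+-comm (∑ (upTo n) h) _) (cong₂ _+_ (+-identityʳ (h n)) (∑-upTo n))))

∑-cells : ∀ n {h} → ∑ (cells n) h ≡ ∑ (downFrom n) (λ d → h (d , pos)) + ∑ (downFrom n) (λ d → h (d , neg))
∑-cells zero        = refl
∑-cells (suc n) {h} = trans (cong (λ z → h (n , pos) + (h (n , neg) + z)) (∑-cells n))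
  (lem (h (n , pos)) (h (n , neg)) _ _)
  where
  lem : ∀ a b x y → a + (b + (x + y)) ≡ (a + x) + (b + y)
  lem = solve-∀

-- Residue 0 has no cell, hence the condition on `h 0`. For even `q` the residue `q/2` has two cells
-- on level 0, and `live` keeps one.
∑-values : ∀ n₀ {b} → b ≤ 1 → ∀ {h : ℕ → ℕ} → h 0 ≡ 0 →
           ∑ (upTo (modulus n₀ b)) h ≡ ∑ (cells (suc n₀)) λ c → live b c * h (value n₀ b c)
∑-values n₀ {b} b≤1 {h} h0≡0 = begin
  ∑ (upTo (modulus n₀ b)) h
    ≡⟨ trans (∑-upTo (modulus n₀ b)) (∑-split (suc (n₀ + b)) (suc n₀)) ⟩
  ∑ (downFrom (suc n₀)) (λ d → h (value n₀ b (d , neg))) + ∑ (downFrom (suc (n₀ + b))) h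
    ≡⟨ trans (cong (∑ (downFrom (suc n₀)) (λ d → h (value n₀ b (d , neg))) +_)
        (trans (∑-first (n₀ + b)) (trans (cong (∑ (downFrom (n₀ + b)) (h ∘ suc) +_) h0≡0) (+-identityʳ _))))
         (parity b≤1) ⟩
  ∑ (downFrom (suc n₀)) (λ d → live b (d , neg) * h (value n₀ b (d , neg))) + ∑ (downFrom (suc n₀)) (h ∘ suc)
    ≡⟨ trans (+-comm negative (∑ (downFrom (suc n₀)) (h ∘ suc))) (cong (_+ negative)
         (trans (sym (∑-reverse (suc n₀) {h})) (∑-cong (downFrom (suc n₀)) λ {d} _ →
             sym (+-identityʳ (h (suc n₀ ∸ d)))))) ⟩
  ∑ (downFrom (suc n₀)) (λ d → 1 * h (value n₀ b (d , pos))) + ∑ (downFrom (suc n₀))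
      (λ d → live b (d , neg) * h (value n₀ b (d , neg)))
    ≡⟨ sym (∑-cells (suc n₀) {λ c → live b c * h (value n₀ b c)}) ⟩
  ∑ (cells (suc n₀)) (λ c → live b c * h (value n₀ b c)) ∎
  where
  open ≡-Reasoning
  negative : ℕ
  negative = ∑ (downFrom (suc n₀)) λ d → live b (d , neg) * h (value n₀ b (d , neg))
  parity : ∀ {b} → b ≤ 1 →
    ∑ (downFrom (suc n₀)) (λ d → h (value n₀ b (d , neg))) + ∑ (downFrom (n₀ + b)) (h ∘ suc) ≡
    ∑ (downFrom (suc n₀)) (λ d → live b (d , neg) * h (value n₀ b (d , neg))) + ∑ (downFrom (suc n₀)) (h ∘ suc)
  parity (s≤s z≤n) = cong₂ _+_ (∑-cong (downFrom (suc n₀)) λ _ → sym (+-identityʳ _))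
    (cong (λ z → ∑ (downFrom z) (h ∘ suc)) (+-comm n₀ 1))
  parity z≤n = begin
    ∑ (downFrom (suc n₀)) (λ d → h (suc (n₀ + 0) + d)) + ∑ (downFrom (n₀ + 0)) (h ∘ suc)
      ≡⟨ cong₂ (λ x y → x + ∑ (downFrom y) (h ∘ suc)) (∑-first n₀) (+-identityʳ n₀) ⟩
    ∑ (downFrom n₀) (λ d → h (suc (n₀ + 0) + suc d)) + h (suc (n₀ + 0) + 0) + ∑ (downFrom n₀) (h ∘ suc)
      ≡⟨ cong (λ z → ∑ (downFrom n₀) (λ d → h (suc (n₀ + 0) + suc d)) + h (suc z) + ∑ (downFrom n₀) (h ∘ suc))
          (trans (+-identityʳ _) (+-identityʳ _)) ⟩
    ∑ (downFrom n₀) (λ d → h (suc (n₀ + 0) + suc d)) + h (suc n₀) + ∑ (downFrom n₀) (h ∘ suc)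
      ≡⟨ +-assoc (∑ (downFrom n₀) (λ d → h (suc (n₀ + 0) + suc d))) _ _ ⟩
    ∑ (downFrom n₀) (λ d → h (suc (n₀ + 0) + suc d)) + ∑ (downFrom (suc n₀)) (h ∘ suc)
      ≡⟨ cong (_+ ∑ (downFrom (suc n₀)) (h ∘ suc)) (sym (trans (∑-first n₀ {λ d → nonzero d * h (suc (n₀ + 0) + d)})
           (trans (+-identityʳ _) (∑-cong (downFrom n₀) λ _ → +-identityʳ _)))) ⟩
    ∑ (downFrom (suc n₀)) (λ d → nonzero d * h (suc (n₀ + 0) + d)) + ∑ (downFrom (suc n₀)) (h ∘ suc) ∎

-- Residues that are compatible in either order: difference and sum both avoid all critical values.
Far : ℕ → ℕ → ℕ → Set
Far q v v′ = (suc v < v′ ⊎ suc v′ < v) × (v + v′ < q ⊎ suc q < v + v′)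

far-sym : ∀ {q v v′} → Far q v v′ → Far q v′ v
far-sym {q} {v} {v′} (diff , sum) = swap⊎ diff , subst (λ z → z < q ⊎ suc q < z) (+-comm v v′) sum

far-shift : ∀ (d g p : ℕ) → suc (suc (d + g)) + p ≡ d + suc (suc (g + p))
far-shift = solve-∀

private
  far-pos-pos-gap : ∀ (g p : ℕ) → suc (suc (suc (g + p))) ≡ suc (suc (suc p) + g)
  far-pos-pos-gap = solve-∀
  far-pos-pos-sum : ∀ (b d g p : ℕ) → suc (suc (suc (d + g)) + p) + suc (suc (suc (d + g)) + p + b) ≡
                   suc (suc (suc (suc (g + p))) + suc p + suc (d + d + g + b))
  far-pos-pos-sum = solve-∀
  far-pos-neg-gap : ∀ (b d g p : ℕ) → suc (suc (suc (d + g)) + p + b) + suc (suc (d + g)) ≡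
      suc (suc (suc (suc (suc (g + p)))) + (d + d + g + b))
  far-pos-neg-gap = solve-∀
  far-pos-neg-sum : ∀ (b d g p : ℕ) → suc (suc (suc (g + p))) +
      (suc (suc (suc (d + g)) + p + b) + suc (suc (d + g))) ≡
                   suc (suc (suc (suc (suc (d + g)) + p) + suc (suc (suc (d + g)) + p + b)) + g)
  far-pos-neg-sum = solve-∀
  far-neg-pos-gap : ∀ (b d g p : ℕ) → suc (suc (suc (d + g)) + p + b) + d ≡ suc (suc (suc p) + (d + d + g + b))
  far-neg-pos-gap = solve-∀
  far-neg-pos-sum : ∀ (b d g p : ℕ) → suc (suc (suc (d + g)) + p) + suc (suc (suc (d + g)) + p + b) ≡
                   suc (suc (suc (suc (d + g)) + p + b) + d + suc p + suc g)
  far-neg-pos-sum = solve-∀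
  far-neg-neg-gap : ∀ (b d g p : ℕ) → suc (suc (suc (d + g)) + p + b) + suc (suc (d + g)) ≡
      suc (suc (suc (suc (suc (d + g)) + p + b) + d) + g)
  far-neg-neg-gap = solve-∀
  far-neg-neg-sum : ∀ (b d g p : ℕ) → suc (suc (suc (d + g)) + p + b) + d +
      (suc (suc (suc (d + g)) + p + b) + suc (suc (d + g))) ≡
                   suc (suc (suc (suc (suc (d + g)) + p) + suc (suc (suc (d + g)) + p + b)) + (b + d + d + g))
  far-neg-neg-sum = solve-∀

far-cells : ∀ {n₀} b d g p σ τ → n₀ ≡ suc (suc (d + g)) + p →
            Far (modulus n₀ b) (value n₀ b (d , σ)) (value n₀ b (suc (suc (d + g)) , τ))
far-cells b d g p pos pos refl = subst₂ (Far (modulus (suc (suc (d + g)) + p) b))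
  (sym (value-pos b d (suc (suc (g + p))) (far-shift d g p))) (sym (value-pos b (suc (suc (d + g))) p refl))
  (inj₂ (excess g (far-pos-pos-gap g p)) , inj₁ (excess (suc (d + d + g + b)) (far-pos-pos-sum b d g p)))
far-cells b d g p pos neg refl = subst (λ z → Far (modulus (suc (suc (d + g)) + p) b) z
    (value (suc (suc (d + g)) + p) b (suc (suc (d + g)) , neg)))
  (sym (value-pos b d (suc (suc (g + p))) (far-shift d g p)))
  (inj₁ (excess (d + d + g + b) (far-pos-neg-gap b d g p)) , inj₂ (excess g (far-pos-neg-sum b d g p)))
far-cells b d g p neg pos refl = subst (Far (modulus (suc (suc (d + g)) + p) b)
    (value (suc (suc (d + g)) + p) b (d , neg)))
  (sym (value-pos b (suc (suc (d + g))) p refl))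
  (inj₂ (excess (d + d + g + b) (far-neg-pos-gap b d g p)) , inj₁ (excess (suc g) (far-neg-pos-sum b d g p)))
far-cells b d g p neg neg refl =
  inj₁ (excess g (far-neg-neg-gap b d g p)) , inj₂ (excess (b + d + d + g) (far-neg-neg-sum b d g p))

-- Neighbouring levels

private
  next-pos-pos-arith : ∀ (b d p : ℕ) → suc (suc d + p) + suc (suc d + p + b) ≡
      suc (suc p + suc (suc p) + (d + d + b))
  next-pos-pos-arith = solve-∀

next-pos-pos : ∀ {n₀} b d p → n₀ ≡ suc d + p → value n₀ b (d , pos) ≡ suc (value n₀ b (suc d , pos)) ×
               value n₀ b (suc d , pos) + value n₀ b (d , pos) < modulus n₀ b
next-pos-pos b d p refl = subst₂ (λ x y → x ≡ suc y × y + x < modulus (suc d + p) b)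
  (sym (value-pos b d (suc p) (sym (+-suc d p)))) (sym (value-pos b (suc d) p refl))
  (refl , excess (d + d + b) (next-pos-pos-arith b d p))

private
  next-pos-neg-arith : ∀ (b d p : ℕ) → suc (suc p) + (suc (suc d + p + b) + suc d) ≡
      suc (suc (suc d + p) + suc (suc d + p + b))
  next-pos-neg-arith = solve-∀

next-pos-neg : ∀ {n₀} b d p → n₀ ≡ suc d + p → value n₀ b (d , pos) + value n₀ b (suc d , neg) ≡ suc (modulus n₀ b)
next-pos-neg b d p refl = trans (cong (_+ (suc (suc d + p + b) + suc d))
    (value-pos b d (suc p) (sym (+-suc d p)))) (next-pos-neg-arith b d p)

private
  next-neg-pos-arith₁ : ∀ (b d p : ℕ) → suc (suc d + p + b) + d ≡ suc (suc p + (d + (b + d)))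
  next-neg-pos-arith₁ = solve-∀
  next-neg-pos-arith₂ : ∀ (d p r : ℕ) → suc (suc p + (d + suc r)) ≡ suc (suc (suc p) + (d + r))
  next-neg-pos-arith₂ = solve-∀
  next-neg-pos-arith₃ : ∀ (b d p : ℕ) → suc (suc d + p) + suc (suc d + p + b) ≡
      suc (suc (suc d + p + b) + d + suc p + 0)
  next-neg-pos-arith₃ = solve-∀

-- The sum is `q - 1`. The difference is `b + 2d + 1`, which exceeds 1 exactly when the negative
-- cell is live.
next-neg-pos : ∀ {n₀} b d p r → b + d ≡ suc r → n₀ ≡ suc d + p →
               Far (modulus n₀ b) (value n₀ b (d , neg)) (value n₀ b (suc d , pos))
next-neg-pos b d p r b+d refl = subst (Far (modulus (suc d + p) b) (value (suc d + p) b (d , neg)))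
    (sym (value-pos b (suc d) p refl)) (
  inj₂ (excess (d + r) (trans (next-neg-pos-arith₁ b d p) (trans (cong (λ z → suc (suc p + (d + z))) b+d)
      (next-neg-pos-arith₂ d p r)))) ,
  inj₁ (excess 0 (next-neg-pos-arith₃ b d p)))

next-neg-neg : ∀ {n₀} b d r → b + d ≡ suc r → value n₀ b (suc d , neg) ≡ suc (value n₀ b (d , neg)) ×
               suc (modulus n₀ b) < value n₀ b (d , neg) + value n₀ b (suc d , neg)
next-neg-neg {n₀} b d r b+d = +-suc (suc (n₀ + b)) d ,
  excess (d + r) (trans (l₁ n₀ b d) (trans (cong (λ z → suc (suc n₀ + suc (n₀ + b) + (d + z))) b+d) (l₂ n₀ b d r)))
  where
  l₁ : ∀ (n₀ b d : ℕ) → suc (n₀ + b) + d + (suc (n₀ + b) + suc d) ≡ suc (suc n₀ + suc (n₀ + b) + (d + (b + d)))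
  l₁ = solve-∀
  l₂ : ∀ (n₀ b d r : ℕ) → suc (suc n₀ + suc (n₀ + b) + (d + suc r)) ≡ suc (suc (suc n₀ + suc (n₀ + b)) + (d + r))
  l₂ = solve-∀

same-level : ∀ {n₀} b d σ τ → d ≤ n₀ → value n₀ b (d , σ) ≡ value n₀ b (d , τ) ⊎
             value n₀ b (d , σ) + value n₀ b (d , τ) ≡ modulus n₀ b
same-level b d pos pos d≤n₀ = inj₁ refl
same-level b d neg neg d≤n₀ = inj₁ refl
same-level {n₀} b d pos neg d≤n₀ = inj₂ (trans (l (suc n₀ ∸ d) n₀ b d)
    (cong (_+ suc (n₀ + b)) (m∸n+n≡m (m≤n⇒m≤1+n d≤n₀))))
  where
  l : ∀ (x n₀ b d : ℕ) → x + (suc (n₀ + b) + d) ≡ x + d + suc (n₀ + b)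
  l = solve-∀
same-level {n₀} b d neg pos d≤n₀ with same-level {n₀} b d pos neg d≤n₀
... | inj₁ eq = inj₁ (sym eq)
... | inj₂ eq = inj₂ (trans (+-comm (suc (n₀ + b) + d) _) eq)

-- Agreement of compatible residues with compatible letters

data Gap : ℕ → ℕ → Set where
  same      : ∀ {d} → Gap d d
  next-above : ∀ {d} → Gap d (suc d)
  next-below : ∀ {d} → Gap (suc d) d
  far-above : ∀ {d} g → Gap d (suc (suc (d + g)))
  far-below : ∀ {d} g → Gap (suc (suc (d + g))) d

gap : ∀ d d′ → Gap d d′
gap zero          zero           = same
gap zero          (suc zero)     = next-above
gap zero          (suc (suc g))  = far-above g
gap (suc zero)    zero           = next-below
gap (suc (suc g)) zero           = far-below g
gap (suc d)       (suc d′) with gap d d′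
... | same        = same
... | next-above  = next-above
... | next-below  = next-below
... | far-above g = far-above g
... | far-below g = far-below g

module Match {m : ℕ} {i j : Fin m} (i<j : i Fin.< j) (n₀ b : ℕ) where

  open Residues (modulus n₀ b) i<j
  open Levels (rank {m}) rank-distinct using (wt; wt-sym)

  private
    v : ℕ × Sgn → ℕ
    v = value n₀ b

    q : ℕ
    q = modulus n₀ b

  away-from-q : ∀ {x} → x < q ⊎ suc q < x → x ≢ q × x ≢ suc q
  away-from-q (inj₁ lt) = <⇒≢ lt , <⇒≢ (<-trans lt (n<1+n q))
  away-from-q (inj₂ lt) = >⇒≢ (<-trans (n<1+n q) lt) , >⇒≢ lt

  make-compatible : ∀ {s t x y} → ¬ (s ≡ i × t ≡ j) → x ≢ y → x ≢ suc y →
                    x + y < q ⊎ suc q < x + y → Compatible s t x y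
  make-compatible ¬ex x≢y x≢1+y sum =
    x≢y , proj₁ (away-from-q sum) , x≢1+y , (λ ex → contradiction ex ¬ex) , λ _ → proj₂ (away-from-q sum)

  far⇒compatible : ∀ {s t x y} → ¬ (s ≡ i × t ≡ j) → Far q x y → Compatible s t x y
  far⇒compatible {x = x} ¬ex (inj₁ lt , sum) =
    make-compatible ¬ex (<⇒≢ (<-trans (n<1+n x) lt)) (<⇒≢ (<-trans (n<1+n x) (<-trans lt (n<1+n _)))) sum
  far⇒compatible {y = y} ¬ex (inj₂ lt , sum) = make-compatible ¬ex (>⇒≢ (<-trans (n<1+n y) lt)) (>⇒≢ lt) sum

  close⇒compatible : ∀ {s t x y} → ¬ (s ≡ i × t ≡ j) → y ≡ suc x →
                     x + y < q ⊎ suc q < x + y → Compatible s t x y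
  close⇒compatible {x = x} ¬ex refl = make-compatible ¬ex (<⇒≢ (n<1+n x)) (<⇒≢ (<-trans (n<1+n x) (n<1+n (suc x))))

  split-≤ : ∀ {d} → d ≤ n₀ → ∃ λ p → n₀ ≡ d + p
  split-≤ {d} d≤n₀ = n₀ ∸ d , sym (m+[n∸m]≡n d≤n₀)

  -- On neighbouring levels, equal signs are obstructed only by `x_s - x_t = 1`, in one of the two
  -- orders, and opposite signs only by `x_s + x_t = 1`, when the negative letter is on the upper
  -- level. The ranks are ordered so that the obstructed cases are the descents.
  match-< : ∀ {s t d d′} σ τ → s Fin.< t → ¬ (s ≡ i × t ≡ j) → Gap d d′ → d ≤ n₀ → d′ ≤ n₀ →
    live b (d , σ) ≢ 0 → live b (d′ , τ) ≢ 0 →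
    ind (compatible? s t (v (d , σ)) (v (d′ , τ))) ≡ wt s (d , σ) t (d′ , τ)
  match-< {s} {t} {d} σ τ s<t ¬ex same d≤ d′≤ live₁ live₂ =
    trans (ind-no (compatible? s t (v (d , σ)) (v (d , τ))) bad) (sym (adj-same d (rank s σ) (rank t τ)))
    where
    bad : ¬ Compatible s t (v (d , σ)) (v (d , τ))
    bad (≢₁ , ≢₂ , _) with same-level b d σ τ d≤
    ... | inj₁ eq = ≢₁ eq
    ... | inj₂ eq = ≢₂ eq
  match-< {s} {t} {d} {d′} σ τ s<t ¬ex (far-above g) d≤ d′≤ live₁ live₂ = trans
    (ind-yes (compatible? s t (v (d , σ)) (v (d′ , τ))) (far⇒compatible ¬ex
        (far-cells b d g _ σ τ (proj₂ (split-≤ d′≤)))))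
    (sym (trans (adj-sym d (rank s σ) d′ (rank t τ)) (adj-far (rank t τ) (rank s σ) (s≤s (s≤s (m≤m+n d g))))))
  match-< {s} {t} {d} {d′} σ τ s<t ¬ex (far-below g) d≤ d′≤ live₁ live₂ = trans
    (ind-yes (compatible? s t (v (d , σ)) (v (d′ , τ))) (far⇒compatible ¬ex
        (far-sym (far-cells b d′ g _ τ σ (proj₂ (split-≤ d≤))))))
    (sym (adj-far (rank s σ) (rank t τ) (s≤s (s≤s (m≤m+n d′ g)))))
  match-< {s} {t} {d} {d′} σ τ s<t ¬ex next-above d≤ d′≤ live₁ live₂ =
    trans (go σ τ live₁ (proj₂ (split-≤ d′≤))) (sym (trans (adj-sym d (rank s σ) (suc d) (rank t τ))
        (adj-next d (rank t τ) (rank s σ))))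
    where
    go : ∀ σ τ {p} → live b (d , σ) ≢ 0 → n₀ ≡ suc d + p →
         ind (compatible? s t (v (d , σ)) (v (suc d , τ))) ≡ le (suc (rank t τ)) (rank s σ)
    go pos pos live₁ n₀≡ = trans
      (ind-no (compatible? s t (v (d , pos)) (v (suc d , pos))) λ (_ , _ , ≢₃ , _) → ≢₃
          (proj₁ (next-pos-pos b d _ n₀≡)))
      (sym (le-no (m<n⇒m<1+n s<t)))
    go pos neg live₁ n₀≡ = trans
      (ind-no (compatible? s t (v (d , pos)) (v (suc d , neg))) λ (_ , _ , _ , _ , ≢₄) → ≢₄ ¬ex
          (next-pos-neg b d _ n₀≡))
      (sym (le-no (m<n⇒m<1+n (rank-pos-neg s t))))
    go neg pos live₁ n₀≡ = trans
      (ind-yes (compatible? s t (v (d , neg)) (v (suc d , pos)))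
        (far⇒compatible ¬ex (next-neg-pos b d _ _ (proj₂ (live-neg b live₁)) n₀≡)))
      (sym (le-yes (rank-pos-neg t s)))
    go neg neg live₁ n₀≡ with next-neg-neg {n₀} b d _ (proj₂ (live-neg b live₁))
    ... | eq , sum = trans
      (ind-yes (compatible? s t (v (d , neg)) (v (suc d , neg))) (close⇒compatible ¬ex eq (inj₂ sum)))
      (sym (le-yes (rank-neg-anti s<t)))
  match-< {s} {t} {_} {d} σ τ s<t ¬ex next-below d≤ d′≤ live₁ live₂ =
    trans (go σ τ live₂ (proj₂ (split-≤ d≤))) (sym (adj-next d (rank s σ) (rank t τ)))
    where
    go : ∀ σ τ {p} → live b (d , τ) ≢ 0 → n₀ ≡ suc d + p →
         ind (compatible? s t (v (suc d , σ)) (v (d , τ))) ≡ le (suc (rank s σ)) (rank t τ)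
    go pos pos live₂ n₀≡ with next-pos-pos b d _ n₀≡
    ... | eq , sum = trans
      (ind-yes (compatible? s t (v (suc d , pos)) (v (d , pos))) (close⇒compatible ¬ex eq (inj₁ sum)))
      (sym (le-yes s<t))
    go neg pos live₂ n₀≡ = trans
      (ind-no (compatible? s t (v (suc d , neg)) (v (d , pos))) λ (_ , _ , _ , _ , ≢₄) →
        ≢₄ ¬ex (trans (+-comm (v (suc d , neg)) _) (next-pos-neg b d _ n₀≡)))
      (sym (le-no (m<n⇒m<1+n (rank-pos-neg t s))))
    go pos neg live₂ n₀≡ = trans
      (ind-yes (compatible? s t (v (suc d , pos)) (v (d , neg)))
        (far⇒compatible ¬ex (far-sym (next-neg-pos b d _ _ (proj₂ (live-neg b live₂)) n₀≡))))
      (sym (le-yes (rank-pos-neg s t)))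
    go neg neg live₂ n₀≡ = trans
      (ind-no (compatible? s t (v (suc d , neg)) (v (d , neg))) λ (_ , _ , ≢₃ , _) →
        ≢₃ (proj₁ (next-neg-neg {n₀} b d _ (proj₂ (live-neg b live₂)))))
      (sym (le-no (m<n⇒m<1+n (rank-neg-anti s<t))))

  match : ∀ {k l c c′} → k ≢ l → ¬ (k ≡ i × l ≡ j) → ¬ (l ≡ i × k ≡ j) → proj₁ c ≤ n₀ → proj₁ c′ ≤ n₀ →
          live b c ≢ 0 → live b c′ ≢ 0 → compat k (v c) l (v c′) ≡ wt k c l c′
  match {k} {l} {c@(d , σ)} {c′@(d′ , τ)} k≢l ¬ex ¬ex′ d≤ d′≤ live₁ live₂ with FinP.<-cmp k l
  ... | tri< k<l _ _ = match-< σ τ k<l ¬ex (gap d d′) d≤ d′≤ live₁ live₂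
  ... | tri≈ _ k≡l _ = contradiction k≡l k≢l
  ... | tri> _ _ l<k = trans (match-< τ σ l<k ¬ex′ (gap d′ d) d′≤ d≤ live₂ live₁) (wt-sym l c′ k c)

-- Extraction of the exempt pair

∑-single : ∀ {A : Set} {xs : List A} {x h} → Unique xs → x ∈ xs →
           (∀ {y} → y ∈ xs → y ≢ x → h y ≡ 0) → ∑ xs h ≡ h x
∑-single {xs = x ∷ xs} {h = h} (x∉ ∷ _) (here refl) zeros =
  trans (cong (h x +_) (∑-zero xs λ y∈ → zeros (there y∈) λ { refl → All.lookup x∉ y∈ refl })) (+-identityʳ (h x))
∑-single {xs = x ∷ xs} {h = h} (x∉ ∷ u) (there y∈) zeros =
  trans (cong (_+ ∑ xs h) (zeros (here refl) λ { refl → All.lookup x∉ y∈ refl })) (∑-single u y∈ (zeros ∘ there))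

cells-∈ : ∀ {n d} σ → d < n → (d , σ) ∈ cells n
cells-∈ {suc n} {d} σ d<sn with d ≟ n
cells-∈ {suc n} pos _ | yes refl = here refl
cells-∈ {suc n} neg _ | yes refl = there (here refl)
cells-∈ {suc n} σ d<sn | no d≢n  = there (there (cells-∈ σ (≤∧≢⇒< (≤-pred d<sn) d≢n)))

cells-unique : ∀ n → Unique (cells n)
cells-unique zero    = []
cells-unique (suc n) =
  ((λ ()) ∷ All.tabulate (λ c∈ eq → <⇒≢ (cells-< c∈) (cong proj₁ (sym eq)))) ∷
  All.tabulate (λ c∈ eq → <⇒≢ (cells-< c∈) (cong proj₁ (sym eq))) ∷ cells-unique n

-- For even q the last block has only positive letters.
bound : ℕ → ℕ → ℕ
bound m zero    = m
bound m (suc _) = m + m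

data IsPartner : ℕ × Sgn → ℕ × Sgn → Set where
  pos-neg : ∀ {d} → IsPartner (d , pos) (suc d , neg)
  neg-pos : ∀ {d} → IsPartner (suc d , neg) (d , pos)

-- Two positive cells sum to at most `q`. Two live negative cells sum to `q + 1` only if both are
-- the residue `(q + 1)/2` on level 0, which distinctness excludes. With opposite signs the sum
-- determines the difference of the levels.
sum⇒partner : ∀ {n₀} b {d d′} σ τ → d ≤ n₀ → d′ ≤ n₀ → live b (d , σ) ≢ 0 → live b (d′ , τ) ≢ 0 →
  value n₀ b (d , σ) ≢ value n₀ b (d′ , τ) →
  value n₀ b (d , σ) + value n₀ b (d′ , τ) ≡ suc (modulus n₀ b) → IsPartner (d , σ) (d′ , τ)
sum⇒partner {n₀} b {d} {d′} pos pos d≤ d′≤ _ _ _ eq = contradiction eq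
  (<⇒≢ (s≤s (+-mono-≤ (m∸n≤m (suc n₀) d) (≤-trans (m∸n≤m (suc n₀) d′) (s≤s (m≤m+n n₀ b))))))
sum⇒partner {n₀} b {d} {d′} pos neg d≤ d′≤ _ _ _ eq = subst (λ z → IsPartner (d , pos) (z , neg))
  (sym (+-cancelˡ-≡ (suc (n₀ + b) + (suc n₀ ∸ d)) d′ (suc d) (trans (l₁ (suc n₀ ∸ d) (suc (n₀ + b)) d′)
    (trans eq (trans (cong (λ z → suc (z + suc (n₀ + b))) (sym (m∸n+n≡m (m≤n⇒m≤1+n d≤))))
        (l₂ (suc n₀ ∸ d) (suc (n₀ + b)) d)))))) pos-neg
  where
  l₁ : ∀ x y d → y + x + d ≡ x + (y + d)
  l₁ = solve-∀
  l₂ : ∀ x y d → suc (x + d + y) ≡ y + x + suc d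
  l₂ = solve-∀
sum⇒partner {n₀} b {d} {d′} neg pos d≤ d′≤ live₁ live₂ ne eq
  with sum⇒partner {n₀} b pos neg d′≤ d≤ live₂ live₁ (ne ∘ sym) (trans (+-comm (suc n₀ ∸ d′) _) eq)
... | pos-neg = neg-pos
sum⇒partner {n₀} b {d} {d′} neg neg d≤ d′≤ live₁ live₂ ne eq with live-neg b live₁ | live-neg b live₂
... | r , b+d | r′ , b+d′ = contradiction (cong (suc (n₀ + b) +_) (trans d≡0 (sym d′≡0))) ne
  where
  l₁ : ∀ n₀ b d d′ → suc (n₀ + b) + suc n₀ + (b + d + d′) ≡ suc (n₀ + b) + d + (suc (n₀ + b) + d′)
  l₁ = solve-∀
  l₂ : ∀ n₀ b → suc (suc n₀ + suc (n₀ + b)) ≡ suc (n₀ + b) + suc n₀ + 1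
  l₂ = solve-∀
  total-one : b + d + d′ ≡ 1
  total-one = +-cancelˡ-≡ (suc (n₀ + b) + suc n₀) _ _ (trans (l₁ n₀ b d d′) (trans eq (l₂ n₀ b)))
  d′≡0 : d′ ≡ 0
  d′≡0 = m+n≡0⇒n≡0 r (suc-injective (trans (sym (cong (_+ d′) b+d)) total-one))
  d≡0 : d ≡ 0
  d≡0 = m+n≡0⇒n≡0 r′ (suc-injective (trans (sym (cong (_+ d) b+d′)) (trans (l₃ b d d′) total-one)))
    where
    l₃ : ∀ b d d′ → b + d′ + d ≡ b + d + d′
    l₃ = solve-∀

module Extraction {m : ℕ} {i j : Fin m} (i<j : i Fin.< j) (N b : ℕ) (b≤1 : b ≤ 1)
  {S : List (Fin m)} (perm : allFin m ↭ i ∷ j ∷ S) (unique : Unique (i ∷ j ∷ S)) where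

  -- There are `suc n₀ = N + 2` levels, of which the pair takes two.
  n₀ q a : ℕ
  n₀ = suc N
  q  = modulus n₀ b
  a  = bound m b

  open Residues q i<j
  open Match i<j n₀ b using (match; split-≤)
  open Levels (rank {m}) rank-distinct

  private
    v : ℕ × Sgn → ℕ
    v = value n₀ b

    unary : ℕ × Sgn → ℕ
    unary c = live b c * nontrivial (v c)

  S-unique : Unique S
  S-unique = AllPairs.tail (AllPairs.tail unique)

  i∉S : ∀ {l} → l ∈ S → i ≢ l
  i∉S = All.lookup (All.tail (AllPairs.head unique))

  j∉S : ∀ {l} → l ∈ S → j ≢ l
  j∉S = All.lookup (AllPairs.head (AllPairs.tail unique))

  value-pos-≥2 : ∀ {d} → d < n₀ → 2 ≤ v (d , pos)
  value-pos-≥2 {d} d<n₀ with split-≤ d<n₀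
  ... | p , eq = subst (2 ≤_) (sym (value-pos b d (suc p) (trans eq (sym (+-suc d p))))) (s≤s (s≤s z≤n))

  top-value : ∀ d (l : Fin m) σ → d ≤ n₀ → d ≢ n₀ → top (suc n₀) m d (rank l σ) ≡ 1
  top-value d l σ d≤ d≢ = top-below m (rank l σ) (s≤s (≤∧≢⇒< d≤ d≢))

  -- Start rank `m` forbids positive letters on the topmost level, that is, residue 1. For even `q`
  -- the bound `m` forbids negative letters on level 0, that is, the second copy of `q/2`.
  unary-free : ∀ l c → proj₁ c ≤ n₀ → unary c ≡ free a (suc n₀) m l c
  unary-free l (d , pos) d≤ = trans (+-identityʳ _) (sym (trans (cong (_* top (suc n₀) m d (toℕ l)) (always b d))
      (trans (+-identityʳ _) tops)))
    where
    always : ∀ b d → allowed (bound m b) d (toℕ l) ≡ 1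
    always b       (suc d) = refl
    always zero    zero    = le-yes (rank-pos-< l)
    always (suc _) zero    = le-yes (≤-trans (rank-pos-< l) (m≤m+n m m))
    tops : top (suc n₀) m d (toℕ l) ≡ nontrivial (v (d , pos))
    tops with d ≟ n₀
    ... | yes refl = trans (top-same n₀ m (toℕ l)) (trans (le-no (rank-pos-< l))
        (cong nontrivial (sym (value-pos b n₀ 0 (sym (+-identityʳ n₀))))))
    ... | no  d≢n₀ = trans (top-value d l pos d≤ d≢n₀) (sym (nontrivial-one (value-pos-≥2 (≤∧≢⇒< d≤ d≢n₀))))
  unary-free l (d , neg) d≤ = cong₂ _*_ (sym (bottoms b b≤1 d)) (sym tops)
    where
    bottoms : ∀ b → b ≤ 1 → ∀ d → allowed (bound m b) d (rank l neg) ≡ live b (d , neg)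
    bottoms zero    _         zero    = le-no (s≤s (rank-neg-≥ l))
    bottoms zero    _         (suc d) = refl
    bottoms (suc _) (s≤s z≤n) zero    = le-yes (rank-neg-< l)
    bottoms (suc _) (s≤s z≤n) (suc d) = refl
    tops : top (suc n₀) m d (rank l neg) ≡ 1
    tops with d ≟ n₀
    ... | yes refl = trans (top-same n₀ m (rank l neg)) (le-yes (rank-neg-≥ l))
    ... | no  d≢n₀ = top-value d l neg d≤ d≢n₀

  rest : ℕ × Sgn → ℕ × Sgn → ℕ
  rest x y = total (λ k c l c′ → compat k (v c) l (v c′)) (cells (suc n₀)) S
    λ l z → unary z * compat i (v x) l (v z) * compat j (v y) l (v z)

  -- Once `i` and `j` are placed, no remaining comparison concerns the exempt pair, so `match`
  -- applies to all of them.
  rest-levels : ∀ x y → proj₁ x ≤ n₀ → proj₁ y ≤ n₀ → live b x ≢ 0 → live b y ≢ 0 →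
    rest x y ≡ total wt (cells (suc n₀)) S λ l z → free a (suc n₀) m l z * (wt i x l z * wt j y l z)
  rest-levels x y x≤ y≤ live-x live-y = total-cong₂ S S-unique unary-match
    λ {k} {l} {c} {c′} k∈ l∈ k≢l c∈ c′∈ uk ul →
      match {c = c} {c′} k≢l (λ (k≡i , _) → i∉S k∈ (sym k≡i)) (λ (l≡i , _) → i∉S l∈ (sym l≡i))
        (≤-pred (cells-< c∈)) (≤-pred (cells-< c′∈)) (alive {c} uk) (alive {c′} ul)
    where
    alive : ∀ {c p p′} → unary c * p * p′ ≢ 0 → live b c ≢ 0
    alive {c} {p} {p′} ne e = ne (zero⇒product-zero p′ (zero⇒product-zero p
        (zero⇒product-zero (nontrivial (v c)) e)))
    unary-match : ∀ {l z} → l ∈ S → z ∈ cells (suc n₀) →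
      unary z * compat i (v x) l (v z) * compat j (v y) l (v z) ≡ free a (suc n₀) m l z * (wt i x l z * wt j y l z)
    unary-match {l} {z} l∈ z∈ with live b z ≟ 0
    ... | yes dead = trans
            (zero⇒product-zero (compat j (v y) l (v z)) (zero⇒product-zero (compat i (v x) l (v z))
                (zero⇒product-zero (nontrivial (v z)) dead)))
            (sym (zero⇒product-zero (wt i x l z * wt j y l z)
              (trans (sym (unary-free l z (≤-pred (cells-< z∈)))) (zero⇒product-zero (nontrivial (v z)) dead))))
    ... | no live-z = trans (*-assoc (unary z) _ _) (cong₂ _*_ (unary-free l z z≤) (cong₂ _*_
            (match {c = x} {z} (i∉S l∈) (λ (_ , l≡j) → j∉S l∈ (sym l≡j)) (λ (l≡i , _) → i∉S l∈ (sym l≡i)) x≤ z≤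
                live-x live-z)
            (match {c = y} {z} (j∉S l∈) (λ (_ , l≡j) → j∉S l∈ (sym l≡j)) (λ (l≡i , _) → i∉S l∈ (sym l≡i)) y≤ z≤
                live-y live-z)))
      where
      z≤ : proj₁ z ≤ n₀
      z≤ = ≤-pred (cells-< z∈)

  live-suc : ∀ e → live b (suc e , neg) ≡ 1
  live-suc e = cong nonzero (+-suc b e)

  unary-pos : ∀ {e} → e < n₀ → unary (e , pos) ≡ 1
  unary-pos e<n₀ = trans (+-identityʳ _) (nontrivial-one (value-pos-≥2 e<n₀))

  unary-neg : ∀ e → unary (suc e , neg) ≡ 1
  unary-neg e = cong (_* 1) (live-suc e)

  rest-pos-neg : ∀ {e} → e < n₀ → rest (e , pos) (suc e , neg) ≡ pairAt a (rank j neg) (rank i pos) e (suc n₀) S m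
  rest-pos-neg {e} e<n₀ = trans
    (rest-levels (e , pos) (suc e , neg) (<⇒≤ e<n₀) e<n₀ (λ ())
        (λ eq → contradiction (trans (sym (live-suc e)) eq) λ ()))
    (total-cong S λ {l} {z} _ _ → cong (free a (suc n₀) m l z *_) (*-comm (wt i (e , pos) l z) _))

  rest-neg-pos : ∀ {e} → e < n₀ → rest (suc e , neg) (e , pos) ≡ pairAt a (rank i neg) (rank j pos) e (suc n₀) S m
  rest-neg-pos {e} e<n₀ =
    rest-levels (suc e , neg) (e , pos) e<n₀ (<⇒≤ e<n₀) (λ eq → contradiction (trans (sym (live-suc e)) eq) λ ())
        (λ ())

  exempt-compatible : ∀ {v v′} → v + v′ ≡ suc q → v ≢ v′ → v ≢ suc v′ → Compatible i j v v′
  exempt-compatible sum ≢₁ ≢₃ = ≢₁ , (λ eq → 1+n≢n (trans (sym sum) eq)) , ≢₃ , (λ _ → sum) , λ ¬ex →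
      contradiction (refl , refl) ¬ex

  pair-gap : ∀ {e} p → n₀ ≡ suc e + p → v (suc e , neg) ≡ suc (v (e , pos)) + (e + (b + e))
  pair-gap {e} p eq = trans (cong (λ z → suc (z + b) + suc e) eq)
    (trans (l b e p) (cong (λ z → suc z + (e + (b + e))) (sym
        (value-pos b e (suc p) (trans eq (sym (+-suc e p)))))))
    where
    l : ∀ b e p → suc (suc e + p + b) + suc e ≡ suc (suc (suc p)) + (e + (b + e))
    l = solve-∀

  compat-pos-neg : ∀ {e} → e < n₀ → compat i (v (e , pos)) j (v (suc e , neg)) ≡ 1
  compat-pos-neg {e} e<n₀ with split-≤ e<n₀
  ... | p , eq = trans (compat-< (v (e , pos)) (v (suc e , neg)) i<j)
    (ind-yes (compatible? i j (v (e , pos)) (v (suc e , neg)))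
      (exempt-compatible (next-pos-neg b e p eq) (<⇒≢ lt) (<⇒≢ (<-trans lt (n<1+n _)))))
    where
    lt : v (e , pos) < v (suc e , neg)
    lt = excess (e + (b + e)) (pair-gap p eq)

  -- The two residues differ by `2e + b + 1`. This is 1 only for `e = 0` and even `q`, where
  -- `x_i = q/2 + 1` and `x_j = q/2` lie on `x_i - x_j = 1`. In the opposite order the difference is
  -- -1, which is permitted.
  compat-neg-pos : ∀ {e} → e < n₀ → compat i (v (suc e , neg)) j (v (e , pos)) ≡ live b (e , neg)
  compat-neg-pos {e} e<n₀ with split-≤ e<n₀ | b + e in b+e
  ... | p , eq | zero = trans (compat-< (v (suc e , neg)) (v (e , pos)) i<j)
    (ind-no (compatible? i j (v (suc e , neg)) (v (e , pos))) λ (_ , _ , ≢₃ , _) → ≢₃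
      (trans (pair-gap p eq) (trans (cong (λ z → suc (v (e , pos)) + z) (cong₂ _+_ (m+n≡0⇒n≡0 b b+e) b+e))
          (+-identityʳ _))))
  ... | p , eq | suc r = trans (compat-< (v (suc e , neg)) (v (e , pos)) i<j)
    (ind-yes (compatible? i j (v (suc e , neg)) (v (e , pos)))
      (exempt-compatible (trans (+-comm (v (suc e , neg)) _) (next-pos-neg b e p eq))
        (>⇒≢ (<-trans (n<1+n _) gt)) (>⇒≢ gt)))
    where
    gt : suc (v (e , pos)) < v (suc e , neg)
    gt = excess (e + r) (trans (pair-gap p eq) (trans (cong (λ z → suc (v (e , pos)) + (e + z)) b+e)
        (l (v (e , pos)) e r)))
      where
      l : ∀ x e r → suc x + (e + suc r) ≡ suc (suc x + (e + r))
      l = solve-∀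

  outer inner : ℕ × Sgn → ℕ
  inner x = ∑ (cells (suc n₀)) λ y → unary y * compat i (v x) j (v y) * rest x y
  outer x = unary x * inner x

  dead-term : ∀ x y → proj₁ x ≤ n₀ → proj₁ y ≤ n₀ → live b x ≢ 0 → ¬ IsPartner x y →
              unary y * compat i (v x) j (v y) * rest x y ≡ 0
  dead-term x@(d , σ) y@(d′ , τ) x≤ y≤ live-x ¬partner = zero⇒product-zero (rest x y) zero-factor
    where
    zero-factor : unary y * compat i (v x) j (v y) ≡ 0
    zero-factor with live b y ≟ 0
    ... | yes dead   = zero⇒product-zero (compat i (v x) j (v y)) (zero⇒product-zero (nontrivial (v y)) dead)
    ... | no  live-y = trans (cong (unary y *_) (trans (compat-< (v x) (v y) i<j)
            (ind-no (compatible? i j (v x) (v y)) λ (≢₁ , _ , _ , sum , _) →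
              ¬partner (sum⇒partner b σ τ x≤ y≤ live-x live-y ≢₁ (sum (refl , refl))))))
            (*-zeroʳ (unary y))

  inner-partner : ∀ x y → proj₁ x ≤ n₀ → proj₁ y ≤ n₀ → live b x ≢ 0 → (∀ {z} → IsPartner x z → z ≡ y) →
                  inner x ≡ unary y * compat i (v x) j (v y) * rest x y
  inner-partner x y x≤ y≤ live-x only = ∑-single (cells-unique (suc n₀)) (cells-∈ (proj₂ y) (s≤s y≤))
    λ {z} z∈ z≢y → dead-term x z x≤ (≤-pred (cells-< z∈)) live-x (z≢y ∘ only)

  outer-pos : ∀ {e} → e < n₀ → outer (e , pos) ≡ pairAt a (rank j neg) (rank i pos) e (suc n₀) S m
  outer-pos {e} e<n₀ = trans (cong₂ _*_ (unary-pos e<n₀)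
      (trans (inner-partner (e , pos) (suc e , neg) (<⇒≤ e<n₀) e<n₀ (λ ()) λ { pos-neg → refl })
        (cong₂ _*_ (cong₂ _*_ (unary-neg e) (compat-pos-neg e<n₀)) (rest-pos-neg e<n₀))))
    (trans (+-identityʳ _) (+-identityʳ _))

  outer-neg : ∀ {e} → e < n₀ → outer (suc e , neg) ≡ live b (e , neg) * pairAt a (rank i neg) (rank j pos) e
      (suc n₀) S m
  outer-neg {e} e<n₀ = trans (cong₂ _*_ (unary-neg e)
      (trans (inner-partner (suc e , neg) (e , pos) e<n₀ (<⇒≤ e<n₀)
          (λ eq → contradiction (trans (sym (live-suc e)) eq) λ ()) λ { neg-pos → refl })
        (cong₂ _*_ (cong₂ _*_ (unary-pos e<n₀) (compat-neg-pos e<n₀)) (rest-neg-pos e<n₀))))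
    (trans (+-identityʳ _) (cong (_* pairAt a (rank i neg) (rank j pos) e (suc n₀) S m)
        (+-identityʳ (live b (e , neg)))))

  -- The cell is residue 1, and `x_i = 1` is in the arrangement.
  outer-bottom : outer (n₀ , pos) ≡ 0
  outer-bottom = cong (λ z → 1 * nontrivial z * inner (n₀ , pos)) (value-pos b n₀ 0 (sym (+-identityʳ n₀)))

  -- A negative cell has its partner one level lower, and there is no level below 0.
  outer-top : outer (0 , neg) ≡ 0
  outer-top with live b (0 , neg) ≟ 0
  ... | yes dead = zero⇒product-zero (inner (0 , neg)) (zero⇒product-zero (nontrivial (v (0 , neg))) dead)
  ... | no  live-0 = trans (cong (unary (0 , neg) *_) (∑-zero (cells (suc n₀)) λ {y} y∈ →
          dead-term (0 , neg) y z≤n (≤-pred (cells-< y∈)) live-0 λ ())) (*-zeroʳ (unary (0 , neg)))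

  downFrom-< : ∀ {n e} → e ∈ downFrom n → e < n
  downFrom-< {suc n} (here refl) = n<1+n n
  downFrom-< {suc n} (there e∈)  = m<n⇒m<1+n (downFrom-< e∈)

  charQP-pairs : charQP m q (hPlus i j (ℤ.+ 1)) ≡
    ∑ (downFrom n₀) (λ e → pairAt a (rank j neg) (rank i pos) e (suc n₀) S m) +
    ∑ (downFrom n₀) (λ e → live b (e , neg) * pairAt a (rank i neg) (rank j pos) e (suc n₀) S m)
  charQP-pairs = begin
    charQP m q (hPlus i j (ℤ.+ 1))
      ≡⟨ charQP-total ⟩
    total compat (upTo q) (allFin m) (λ _ → nontrivial)
      ≡⟨ total-↭ compat-sym perm _ ⟩
    total compat (upTo q) (i ∷ j ∷ S) (λ _ → nontrivial)
      ≡⟨ total-change-values {w = compat} v (live b) {upTo q} {cells (suc n₀)} (i ∷ j ∷ S) (λ _ → nontrivial)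
          (λ {h} zeros → ∑-values n₀ b≤1 {h} (zeros 0 λ _ → refl)) ⟩
    ∑ (cells (suc n₀)) outer
      ≡⟨ ∑-cells (suc n₀) {outer} ⟩
    outer (n₀ , pos) + ∑ (downFrom n₀) (λ e → outer (e , pos)) + ∑ (downFrom (suc n₀)) (λ e → outer (e , neg))
      ≡⟨ cong₂ _+_ (cong₂ _+_ outer-bottom (∑-cong (downFrom n₀) (outer-pos ∘ downFrom-<)))
           (trans (∑-first n₀ {λ e → outer (e , neg)}) (trans
               (cong₂ _+_ (∑-cong (downFrom n₀) (outer-neg ∘ downFrom-<)) outer-top) (+-identityʳ _))) ⟩
    ∑ (downFrom n₀) (λ e → pairAt a (rank j neg) (rank i pos) e (suc n₀) S m) +
    ∑ (downFrom n₀) (λ e → live b (e , neg) * pairAt a (rank i neg) (rank j pos) e (suc n₀) S m) ∎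
    where open ≡-Reasoning

-- Evaluation of the products

extract : ∀ {A : Set} {x : A} {xs} → x ∈ xs → ∃ λ ys → xs ↭ x ∷ ys
extract x∈ with ∈-∃++ x∈
... | ys , zs , eq = ys ++ zs , ↭-trans (↭-reflexive eq) (shift _ ys zs)

extract-pair : ∀ {m} {i j : Fin m} → j ≢ i → ∃ λ S → allFin m ↭ i ∷ j ∷ S
extract-pair {i = i} {j} j≢i with extract (∈-allFin i)
... | ys , p with ∈-resp-↭ p (∈-allFin j)
...   | here j≡i = contradiction j≡i j≢i
...   | there j∈ with extract j∈
...     | S , p′ = S , ↭-trans p (prep i p′)

less : ∀ {m} → Fin m → Fin m → ℕ
less x l = le (suc (toℕ x)) (toℕ l)

less-neg : ∀ {m} (x l : Fin m) → le (suc (rank l neg)) (rank x neg) ≡ less x l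
less-neg x l with FinP.<-cmp x l
... | tri< x<l _ _  = trans (le-yes (rank-neg-anti x<l)) (sym (le-yes x<l))
... | tri≈ _ refl _ = trans (le-no (n<1+n (rank x neg))) (sym (le-no (n<1+n (toℕ x))))
... | tri> _ _ l<x  = trans (le-no (m<n⇒m<1+n (rank-neg-anti l<x))) (sym (le-no (m<n⇒m<1+n l<x)))

∏-tabulate-const : ∀ {A : Set} n (f : Fin n → A) {g : A → ℕ} {c} → (∀ k → g (f k) ≡ c) → ∏ (tabulate f) g ≡ c ^ n
∏-tabulate-const zero    f h = refl
∏-tabulate-const (suc n) f h = cong₂ _*_ (h Fin.zero) (∏-tabulate-const n (f ∘ Fin.suc) (h ∘ Fin.suc))

∏-tabulate-split : ∀ {A : Set} {n} (f : Fin n → A) {g : A → ℕ} {x y} j →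
  (∀ k → k Fin.< j → g (f k) ≡ x) → g (f j) ≡ 1 → (∀ k → j Fin.< k → g (f k) ≡ y) →
  ∏ (tabulate f) g ≡ x ^ toℕ j * y ^ (n ∸ suc (toℕ j))
∏-tabulate-split {n = suc n} f Fin.zero    lo at hi = cong₂ _*_ at
    (∏-tabulate-const n (f ∘ Fin.suc) λ k → hi (Fin.suc k) (s≤s z≤n))
∏-tabulate-split {n = suc n} f {x = x} (Fin.suc j) lo at hi =
  trans (cong₂ _*_ (lo Fin.zero (s≤s z≤n)) (∏-tabulate-split (f ∘ Fin.suc) j (λ k → lo (Fin.suc k) ∘ s≤s) at λ k →
      hi (Fin.suc k) ∘ s≤s))
    (sym (*-assoc x _ _))

∏-tabulate-split₂ : ∀ {A : Set} {n} (f : Fin n → A) {g : A → ℕ} {x y z} i j → i Fin.< j →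
  (∀ k → k Fin.< i → g (f k) ≡ x) → g (f i) ≡ 1 → (∀ k → i Fin.< k → k Fin.< j → g (f k) ≡ y) →
  g (f j) ≡ 1 → (∀ k → j Fin.< k → g (f k) ≡ z) →
  ∏ (tabulate f) g ≡ x ^ toℕ i * (y ^ (toℕ j ∸ suc (toℕ i)) * z ^ (n ∸ suc (toℕ j)))
∏-tabulate-split₂ {n = suc n} f Fin.zero (Fin.suc j) i<j lo at-i mid at-j hi =
  cong₂ _*_ at-i (∏-tabulate-split (f ∘ Fin.suc) j (λ k → mid (Fin.suc k) (s≤s z≤n) ∘ s≤s) at-j λ k → hi
      (Fin.suc k) ∘ s≤s)
∏-tabulate-split₂ {n = suc n} f {x = x} (Fin.suc i) (Fin.suc j) (s≤s i<j) lo at-i mid at-j hi =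
  trans (cong₂ _*_ (lo Fin.zero (s≤s z≤n)) (∏-tabulate-split₂ (f ∘ Fin.suc) i j i<j (λ k → lo (Fin.suc k) ∘ s≤s)
      at-i
      (λ k p q → mid (Fin.suc k) (s≤s p) (s≤s q)) at-j λ k → hi (Fin.suc k) ∘ s≤s))
    (sym (*-assoc x _ _))

-- Setting the factors of `i` and `j` to 1 extends the product to all coordinates in their natural
-- order; the exponents are the numbers of coordinates before `i`, between `i` and `j`, and after
-- `j`.
∏-others : ∀ {m} {i j : Fin m} {S} → i Fin.< j → allFin m ↭ i ∷ j ∷ S → Unique (i ∷ j ∷ S) → ∀ (φ : Fin m → ℕ)
    {x y z} →
  (∀ k → k Fin.< i → φ k ≡ x) → (∀ k → i Fin.< k → k Fin.< j → φ k ≡ y) → (∀ k → j Fin.< k → φ k ≡ z) →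
  ∏ S φ ≡ x ^ toℕ i * (y ^ (toℕ j ∸ suc (toℕ i)) * z ^ (m ∸ suc (toℕ j)))
∏-others {m} {i} {j} {S} i<j perm ((_ ∷ i∉) ∷ j∉ ∷ _) φ lo mid hi = begin
  ∏ S φ                 ≡⟨ ∏-cong S (λ {l} l∈ → sym (away (All.lookup i∉ l∈ ∘ sym) (All.lookup j∉ l∈ ∘ sym))) ⟩
  ∏ S ψ                 ≡⟨ sym (trans (cong₂ (λ p r → p * (r * ∏ S ψ)) at-i at-j)
      (trans (+-identityʳ _) (+-identityʳ _))) ⟩
  ∏ (i ∷ j ∷ S) ψ       ≡⟨ sym (∏-↭ perm) ⟩
  ∏ (allFin m) ψ        ≡⟨ ∏-tabulate-split₂ id i j i<j
                             (λ k k<i → trans (away (λ { refl → <-irrefl refl k<i })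
                                 (λ { refl → <-asym k<i i<j })) (lo k k<i)) at-i
                             (λ k i<k k<j → trans (away (λ { refl → <-irrefl refl i<k })
                                 (λ { refl → <-irrefl refl k<j })) (mid k i<k k<j)) at-j
                             (λ k j<k → trans (away (λ { refl → <-asym j<k i<j })
                                 (λ { refl → <-irrefl refl j<k })) (hi k j<k)) ⟩
  _                     ∎
  where
  open ≡-Reasoning
  ψ : Fin m → ℕ
  ψ l with l Fin.≟ i | l Fin.≟ j
  ... | no _ | no _ = φ l
  ... | _    | _    = 1
  away : ∀ {l} → l ≢ i → l ≢ j → ψ l ≡ φ l
  away {l} l≢i l≢j with l Fin.≟ i | l Fin.≟ j
  ... | no _    | no _    = refl
  ... | yes l≡i | _       = contradiction l≡i l≢i
  ... | no _    | yes l≡j = contradiction l≡j l≢j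
  at-i : ψ i ≡ 1
  at-i with i Fin.≟ i
  ... | yes _ = refl
  ... | no ne = contradiction refl ne
  at-j : ψ j ≡ 1
  at-j with j Fin.≟ i | j Fin.≟ j
  ... | yes _ | _     = refl
  ... | no _  | yes _ = refl
  ... | no _  | no ne = contradiction refl ne

module Evaluation {m : ℕ} (E : ℕ) where

  module _ (b : ℕ) (b≤1 : b ≤ 1) where

    open Words (rank {m}) rank-distinct (bound m b)

    -- This is `q - 2m`, since `2 + E` empty levels mean `q = 2 (m + 2 + E) + b`.
    free-choices : ℕ
    free-choices = 4 + 2 * E + b

    -- The last block offers `1 + b` signs, every other block both.
    later-value : ∀ E l → later (suc E) l ≡ 1 + b + 2 * E
    later-value zero    l = trans (first b b≤1) (sym (+-identityʳ (1 + b)))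
      where
      first : ∀ b → b ≤ 1 → ∑± (λ σ → allowed (bound m b) 0 (rank l σ)) ≡ 1 + b
      first zero    _         = cong₂ _+_ (le-yes (rank-pos-< l)) (le-no (s≤s (rank-neg-≥ l)))
      first (suc _) (s≤s z≤n) = cong₂ _+_ (le-yes (≤-trans (rank-pos-< l) (m≤m+n m m))) (le-yes (rank-neg-< l))
    later-value (suc E) l = trans (cong (_+ 2) (later-value E l)) (l′ b E)
      where
      l′ : ∀ b E → 1 + b + 2 * E + 2 ≡ 1 + b + 2 * (1 + E)
      l′ = solve-∀

    module _ (x y : Fin m) where

      x<bound : toℕ x < bound m b
      x<bound = <-≤-trans (rank-pos-< x) (≤-bound b)
        where
        ≤-bound : ∀ b → m ≤ bound m b
        ≤-bound zero    = ≤-refl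
        ≤-bound (suc _) = m≤m+n m m

      open Pairs (rank y neg) (rank x pos) x<bound

      from-pair : ∀ l → from (allowed (bound m b) 1) (suc (toℕ x)) l ≡ less x l + 1
      from-pair l = cong₂ _+_ (*-identityʳ (less x l)) (cong (_* 1) (le-yes (rank-pos-neg x l)))

      from-start : ∀ l → from below m l ≡ less y l
      from-start l = cong₂ (λ p r → p * below (toℕ l) + r) (le-no (rank-pos-< l))
        (trans (cong₂ _*_ (le-yes (rank-neg-≥ l)) (less-neg y l)) (+-identityʳ (less y l)))

      from-all : ∀ l → from below 0 l ≡ 1 + less y l
      from-all l = cong₂ _+_ (trans (+-identityʳ (below (toℕ l))) (le-yes (rank-pos-neg l y)))
                             (trans (+-identityʳ (below (rank l neg))) (less-neg y l))

      -- The pair is in the first block. Ahead of it only negative letters below that of `y` fit,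
      -- behind it all negative letters and the positive ones above that of `x`.
      near-value : ∀ l → factor below (afterPair (2 + E)) m l ≡ free-choices + (less x l + less y l)
      near-value l = trans (cong₂ _+_ (cong₂ _+_ (later-value (suc E) l) (from-pair l)) (from-start l))
        (l′ b E (less x l) (less y l))
        where
        l′ : ∀ b E p r → 1 + b + 2 * (1 + E) + (p + 1) + r ≡ 4 + 2 * E + b + (p + r)
        l′ = solve-∀

      -- The first block now offers just the negative letter, but ahead of the pair, in its later
      -- block, positive letters fit too; the total is as in `near-value`.
      far-value : ∀ l → factor one (outside (2 + E)) m l ≡ free-choices + (less x l + less y l)
      far-value l = trans (cong₂ _+_
          (cong₂ _+_ (cong₂ _+_ (later-value E l) (from-pair l)) (from-all l))
          (cong₂ (λ p r → p * 1 + r * 1) (le-no (rank-pos-< l)) (le-yes (rank-neg-≥ l))))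
        (l′ b E (less x l) (less y l))
        where
        l′ : ∀ b E p r → 1 + b + 2 * E + (p + 1) + (1 + r) + 1 ≡ 4 + 2 * E + b + (p + r)
        l′ = solve-∀

      pairWords-value : ∀ {S} → Unique S →
        pairWords (2 + E + length S) S m ≡ (3 + E) * ∏ S λ l → free-choices + (less x l + less y l)
      pairWords-value {S} uS = trans (pairWords-closed _ (2 + E) S m uS refl)
        (cong₂ _+_ (trans (cong (_* ∏ S (factor below (afterPair (2 + E)) m)) (le-yes (rank-neg-≥ y)))
                     (trans (+-identityʳ _) (∏-cong S λ {l} _ → near-value l)))
          (cong ((2 + E) *_) (∏-cong S λ {l} _ → far-value l)))

  -- Counts the placements with the pair (-i, +j) on the last two levels. Then the last block offers
  -- `1 + less i l` choices, the first block one, and the `1 + E` blocks between them two each.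
  words-value : ∀ (i : Fin m) {S} → Unique S →
    Words.words (rank {m}) rank-distinct (rank i neg) (2 + E + length S) S m ≡ ∏ S λ l → 4 + 2 * E + less i l
  words-value i {S} uS = trans (words-closed _ (2 + E) S m uS refl) (∏-cong S λ {l} _ →
      trans (cong₂ _+_ (later-below (suc E) l)
          (cong₂ (λ p r → p * 1 + r * 1) (le-no (rank-pos-< l)) (le-yes (rank-neg-≥ l))))
        (l″ E (less i l)))
    where
    open Words (rank {m}) rank-distinct (rank i neg)
    l″ : ∀ E p → 1 + p + 2 * (1 + E) + 1 ≡ 4 + 2 * E + p
    l″ = solve-∀
    later-below : ∀ E l → later (suc E) l ≡ 1 + less i l + 2 * E
    later-below zero    l = trans (cong₂ _+_ (le-yes (rank-pos-neg l i)) (less-neg i l))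
        (sym (+-identityʳ (1 + less i l)))
    later-below (suc E) l = trans (cong (_+ 2) (later-below E l)) (l′ (less i l) E)
      where
      l′ : ∀ p E → 1 + p + 2 * E + 2 ≡ 1 + p + 2 * (1 + E)
      l′ = solve-∀

-- The two parities

module Final {m : ℕ} {i j : Fin m} (i<j : i Fin.< j) (E : ℕ)
  {S : List (Fin m)} (perm : allFin m ↭ i ∷ j ∷ S) (unique : Unique (i ∷ j ∷ S)) where

  private
    N t : ℕ
    N = 2 + E + length S
    t = 4 + 2 * E

    uS : Unique S
    uS = AllPairs.tail (AllPairs.tail unique)

  powers : ℕ → ℕ → ℕ → ℕ
  powers x y z = x ^ toℕ i * (y ^ (toℕ j ∸ suc (toℕ i)) * z ^ (m ∸ suc (toℕ j)))

  ∏-both : ∀ c → ∏ S (λ l → c + (less i l + less j l)) ≡ powers c (1 + c) (2 + c)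
  ∏-both c = ∏-others i<j perm unique _
    (λ k k<i → trans (cong₂ (λ p r → c + (p + r)) (le-no (m<n⇒m<1+n k<i)) (le-no (m<n⇒m<1+n (<-trans k<i i<j))))
        (+-identityʳ c))
    (λ k i<k k<j → trans (cong₂ (λ p r → c + (p + r)) (le-yes i<k) (le-no (m<n⇒m<1+n k<j))) (+-comm c 1))
    (λ k j<k → trans (cong₂ (λ p r → c + (p + r)) (le-yes (<-trans i<j j<k)) (le-yes j<k)) (+-comm c 2))

  ∏-left : ∀ c → ∏ S (λ l → c + less i l) ≡ powers c (1 + c) (1 + c)
  ∏-left c = ∏-others i<j perm unique _
    (λ k k<i → trans (cong (c +_) (le-no (m<n⇒m<1+n k<i))) (+-identityʳ c))
    (λ k i<k k<j → trans (cong (c +_) (le-yes i<k)) (+-comm c 1))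
    (λ k j<k → trans (cong (c +_) (le-yes (<-trans i<j j<k))) (+-comm c 1))

  module _ (b : ℕ) (b≤1 : b ≤ 1) where

    open Extraction i<j N b b≤1 perm unique
    open Levels (rank {m}) rank-distinct

    pairs-value : ∀ x y → (∀ c → ∏ S (λ l → c + (less x l + less y l)) ≡ powers c (1 + c) (2 + c)) →
      ∑ (downFrom (suc N)) (λ e → pairAt (bound m b) (rank y neg) (rank x pos) e (2 + N) S m) ≡
      (3 + E) * powers (t + b) (1 + (t + b)) (2 + (t + b))
    pairs-value x y ∏≡ = trans (pairAt-sum (bound m b) (rank y neg) (rank x pos) (Evaluation.x<bound E b b≤1 x y)
        N S m (rank-neg-≥ y))
      (trans (Evaluation.pairWords-value E b b≤1 x y uS) (cong ((3 + E) *_) (∏≡ (t + b))))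

    ∏-both′ : ∀ c → ∏ S (λ l → c + (less j l + less i l)) ≡ powers c (1 + c) (2 + c)
    ∏-both′ c = trans (∏-cong S λ {l} _ → cong (c +_) (+-comm (less j l) (less i l))) (∏-both c)

  count-odd : charQP m (modulus (suc N) 1) (hPlus i j (ℤ.+ 1)) ≡ (6 + 2 * E) * powers (1 + t) (2 + t) (3 + t)
  count-odd = trans charQP-pairs (trans (cong₂ _+_ (pairs-value 1 ≤-refl i j ∏-both)
      (trans (∑-cong (downFrom (suc N)) λ {e} _ → +-identityʳ (second e))
          (pairs-value 1 ≤-refl j i (∏-both′ 1 ≤-refl))))
    (trans (double E (powers (t + 1) (1 + (t + 1)) (2 + (t + 1))))
        (cong (λ z → (6 + 2 * E) * powers z (1 + z) (2 + z)) (+-comm t 1))))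
    where
    open Extraction i<j N 1 ≤-refl perm unique using (charQP-pairs)
    open Levels (rank {m}) rank-distinct
    second : ℕ → ℕ
    second e = pairAt (bound m 1) (rank i neg) (rank j pos) e (2 + N) S m
    double : ∀ E P → (3 + E) * P + (3 + E) * P ≡ (6 + 2 * E) * P
    double = solve-∀

  -- The correction is added on the left to avoid truncated subtraction. It equals `second 0`, the
  -- term that `live` removes from the sum over the positions of (-i, +j).
  count-even : charQP m (modulus (suc N) 0) (hPlus i j (ℤ.+ 1)) + powers t (1 + t) (1 + t) ≡
               (6 + 2 * E) * powers t (1 + t) (2 + t)
  count-even = begin
    charQP m (modulus (suc N) 0) (hPlus i j (ℤ.+ 1)) + powers t (1 + t) (1 + t)
      ≡⟨ cong₂ _+_ charQP-pairs (sym (trans (pairAt-bottom m (rank i neg) (rank j pos) N S m)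
          (trans (Evaluation.words-value E i uS) (∏-left t)))) ⟩
    ∑ (downFrom (suc N)) first + ∑ (downFrom (suc N)) (λ e → nonzero e * second e) + second 0
      ≡⟨ +-assoc (∑ (downFrom (suc N)) first) _ _ ⟩
    ∑ (downFrom (suc N)) first + (∑ (downFrom (suc N)) (λ e → nonzero e * second e) + second 0)
      ≡⟨ cong (∑ (downFrom (suc N)) first +_) (trans (cong (_+ second 0)
          (trans (∑-first N {λ e → nonzero e * second e}) (+-identityʳ _)))
           (trans (cong (_+ second 0) (∑-cong (downFrom N) λ {e} _ → +-identityʳ (second (suc e))))
               (sym (∑-first N {second})))) ⟩
    ∑ (downFrom (suc N)) first + ∑ (downFrom (suc N)) second
      ≡⟨ cong₂ _+_ (pairs-value 0 z≤n i j ∏-both) (pairs-value 0 z≤n j i (∏-both′ 0 z≤n)) ⟩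
    (3 + E) * powers (t + 0) (1 + (t + 0)) (2 + (t + 0)) + (3 + E) * powers (t + 0) (1 + (t + 0)) (2 + (t + 0))
      ≡⟨ trans (double E (powers (t + 0) (1 + (t + 0)) (2 + (t + 0))))
          (cong (λ z → (6 + 2 * E) * powers z (1 + z) (2 + z)) (+-identityʳ t)) ⟩
    (6 + 2 * E) * powers t (1 + t) (2 + t) ∎
    where
    open ≡-Reasoning
    open Extraction i<j N 0 z≤n perm unique using (charQP-pairs)
    open Levels (rank {m}) rank-distinct
    first second : ℕ → ℕ
    first e  = pairAt m (rank j neg) (rank i pos) e (2 + N) S m
    second e = pairAt m (rank i neg) (rank j pos) e (2 + N) S m
    double : ∀ E P → (3 + E) * P + (3 + E) * P ≡ (6 + 2 * E) * P
    double = solve-∀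

-- Integer formulas and large moduli

open import Data.Integer using (+_)

even-or-odd : ∀ q → ∃ λ k → q ≡ k * 2 ⊎ q ≡ suc (k * 2)
even-or-odd zero = 0 , inj₁ refl
even-or-odd (suc q) with even-or-odd q
... | k , inj₁ refl = k , inj₂ refl
... | k , inj₂ refl = suc k , inj₁ refl

pos-^ : ∀ x k → + (x ^ k) ≡ (+ x) ℤ.^ k
pos-^ x zero    = refl
pos-^ x (suc k) = trans (ℤP.pos-* x (x ^ k)) (cong (λ z → + x ℤ.* z) (pos-^ x k))

module Assembly {m : ℕ} {i j : Fin m} (i<j : i Fin.< j) (E : ℕ) where

  private
    S,perm : ∃ λ S → allFin m ↭ i ∷ j ∷ S
    S,perm = extract-pair {i = i} {j} λ { refl → <-irrefl refl i<j }

    S : List (Fin m)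
    S = proj₁ S,perm

    perm : allFin m ↭ i ∷ j ∷ S
    perm = proj₂ S,perm

    t N : ℕ
    t = 4 + 2 * E
    N = 2 + E + length S

    m≡ : m ≡ 2 + length S
    m≡ = trans (sym (length-tabulate {n = m} id)) (↭-length perm)

    open Final i<j E perm (Unique-↭ (↭-sym perm) (allFin⁺ m))

    half : (m + 2 + E) ≡ 2 + N
    half = trans (cong (λ z → z + 2 + E) m≡) (l E (length S))
      where
      l : ∀ E s → 2 + s + 2 + E ≡ 2 + (2 + E + s)
      l = solve-∀

    shift-≡ : ∀ {q x y} → q ≡ x + 2 * m → y ≡ x → + q ℤ.- + (2 * m) ≡ + y
    shift-≡ {x = x} refl refl = trans (cong (λ z → z ℤ.- + (2 * m)) (ℤP.pos-+ x (2 * m))) (l (+ x) (+ (2 * m)))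
      where
      l : ∀ a b → a ℤ.+ b ℤ.- b ≡ a
      l = ℤSolver.solve-∀

    modulus-odd : suc ((m + 2 + E) * 2) ≡ modulus (suc N) 1
    modulus-odd = trans (cong (λ z → suc (z * 2)) half) (l N)
      where
      l : ∀ N → suc ((2 + N) * 2) ≡ suc (suc N) + suc (suc N + 1)
      l = solve-∀

    modulus-even : (m + 2 + E) * 2 ≡ modulus (suc N) 0
    modulus-even = trans (cong (_* 2) half) (l N)
      where
      l : ∀ N → (2 + N) * 2 ≡ suc (suc N) + suc (suc N + 0)
      l = solve-∀

    gap-≡ : toℕ j ∸ toℕ i ≡ suc (toℕ j ∸ suc (toℕ i))
    gap-≡ = +-∸-assoc 1 i<j

    gap-pred : toℕ j ∸ toℕ i ∸ 1 ≡ toℕ j ∸ suc (toℕ i)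
    gap-pred = cong (_∸ 1) gap-≡

  -- The factor `6 + 2 * E` is the base `2 + t` of the coordinates between `i` and `j`, whose
  -- exponent becomes `j - i`.
  odd-case : + charQP m (suc ((m + 2 + E) * 2)) (hPlus i j (+ 1)) ≡ oddFormula m (suc ((m + 2 + E) * 2)) i j
  odd-case = begin
    + charQP m (suc ((m + 2 + E) * 2)) (hPlus i j (+ 1))
      ≡⟨ cong (λ q → + charQP m q (hPlus i j (+ 1))) modulus-odd ⟩
    + charQP m (modulus (suc N) 1) (hPlus i j (+ 1))
      ≡⟨ cong +_ (trans count-odd (trans (l E ((1 + t) ^ toℕ i) ((2 + t) ^ (toℕ j ∸ suc (toℕ i)))
          ((3 + t) ^ (m ∸ suc (toℕ j))))
             (cong₂ (λ y z → (1 + t) ^ toℕ i * y ^ suc (toℕ j ∸ suc (toℕ i)) * z ^ (m ∸ suc (toℕ j)))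
                 (+-comm 1 (1 + t)) (+-comm 2 (1 + t))))) ⟩
    + ((1 + t) ^ toℕ i * (1 + t + 1) ^ suc (toℕ j ∸ suc (toℕ i)) * (1 + t + 2) ^ (m ∸ suc (toℕ j)))
      ≡⟨ trans (ℤP.pos-* ((1 + t) ^ toℕ i * (1 + t + 1) ^ suc (toℕ j ∸ suc (toℕ i))) _)
           (cong₂ ℤ._*_ (trans (ℤP.pos-* ((1 + t) ^ toℕ i) _)
               (cong₂ ℤ._*_ (pos-^ (1 + t) (toℕ i)) (pos-^ (1 + t + 1) (suc (toℕ j ∸ suc (toℕ i))))))
             (pos-^ (1 + t + 2) (m ∸ suc (toℕ j)))) ⟩
    (+ (1 + t)) ℤ.^ toℕ i ℤ.* (+ (1 + t) ℤ.+ + 1) ℤ.^ suc (toℕ j ∸ suc (toℕ i)) ℤ.* (+ (1 + t) ℤ.+ + 2) ℤ.^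
        (m ∸ suc (toℕ j))
      ≡⟨ cong₂ (λ z g → z ℤ.^ toℕ i ℤ.* (z ℤ.+ + 1) ℤ.^ g ℤ.* (z ℤ.+ + 2) ℤ.^ (m ∸ suc (toℕ j)))
           (sym (shift-≡ (l′ m E) refl)) (sym gap-≡) ⟩
    oddFormula m (suc ((m + 2 + E) * 2)) i j ∎
    where
    open ≡-Reasoning
    l′ : ∀ m E → suc ((m + 2 + E) * 2) ≡ 1 + (4 + 2 * E) + 2 * m
    l′ = solve-∀
    l : ∀ E x y z → (6 + 2 * E) * (x * (y * z)) ≡ x * ((6 + 2 * E) * y) * z
    l = solve-∀

  -- The factor `6 + 2 * E` is the base `2 + t` of the coordinates after `j`. The correction shares
  -- the powers for the coordinates before `j`, so these can be factored out.
  even-case : + charQP m ((m + 2 + E) * 2) (hPlus i j (+ 1)) ≡ evenFormula m ((m + 2 + E) * 2) i j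
  even-case = begin
    + charQP m ((m + 2 + E) * 2) (hPlus i j (+ 1))
      ≡⟨ cong (λ q → + charQP m q (hPlus i j (+ 1))) modulus-even ⟩
    + count
      ≡⟨ sym (cancel (+ count) (+ corrected)) ⟩
    + (count + corrected) ℤ.- + corrected
      ≡⟨ cong₂ (λ x y → + x ℤ.- + y) (trans count-even (l E X Y (z ^ h))) (sym (*-assoc X Y (y ^ h))) ⟩
    + (X * Y * (z * z ^ h)) ℤ.- + (X * Y * y ^ h)
      ≡⟨ cong₂ ℤ._-_ (ℤP.pos-* (X * Y) (z * z ^ h)) (ℤP.pos-* (X * Y) (y ^ h)) ⟩
    + (X * Y) ℤ.* + (z ^ suc h) ℤ.- + (X * Y) ℤ.* + (y ^ h)
      ≡⟨ factor-out (+ (X * Y)) (+ (z ^ suc h)) (+ (y ^ h)) ⟩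
    + (X * Y) ℤ.* (+ (z ^ suc h) ℤ.- + (y ^ h))
      ≡⟨ cong₂ ℤ._*_ (trans (ℤP.pos-* X Y) (cong₂ ℤ._*_ (pos-^ t (toℕ i)) (pos-^ y g)))
          (cong₂ ℤ._-_ (pos-^ z (suc h)) (pos-^ y h)) ⟩
    (+ t) ℤ.^ toℕ i ℤ.* (+ y) ℤ.^ g ℤ.* ((+ z) ℤ.^ suc h ℤ.- (+ y) ℤ.^ h)
      ≡⟨ cong₂ (λ y z → (+ t) ℤ.^ toℕ i ℤ.* (+ y) ℤ.^ g ℤ.* ((+ z) ℤ.^ suc h ℤ.- (+ y) ℤ.^ h)) (+-comm 1 t)
          (+-comm 2 t) ⟩
    (+ t) ℤ.^ toℕ i ℤ.* (+ t ℤ.+ + 1) ℤ.^ g ℤ.* ((+ t ℤ.+ + 2) ℤ.^ suc h ℤ.- (+ t ℤ.+ + 1) ℤ.^ h)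
      ≡⟨ cong₂ (λ x (g , h′) → x ℤ.^ toℕ i ℤ.* (x ℤ.+ + 1) ℤ.^ g ℤ.* ((x ℤ.+ + 2) ℤ.^ h′ ℤ.- (x ℤ.+ + 1) ℤ.^ h))
           (sym (shift-≡ (l′ m E) refl)) (cong₂ _,_ (sym gap-pred) (+-comm 1 h)) ⟩
    evenFormula m ((m + 2 + E) * 2) i j ∎
    where
    open ≡-Reasoning
    g h y z X Y count corrected : ℕ
    g = toℕ j ∸ suc (toℕ i)
    h = m ∸ suc (toℕ j)
    y = 1 + t
    z = 2 + t
    X = t ^ toℕ i
    Y = y ^ g
    count = charQP m (modulus (suc N) 0) (hPlus i j (+ 1))
    corrected = powers t (1 + t) (1 + t)
    cancel : ∀ a b → a ℤ.+ b ℤ.- b ≡ a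
    cancel = ℤSolver.solve-∀
    factor-out : ∀ a b c → a ℤ.* b ℤ.- a ℤ.* c ≡ a ℤ.* (b ℤ.- c)
    factor-out = ℤSolver.solve-∀
    l′ : ∀ m E → (m + 2 + E) * 2 ≡ 4 + 2 * E + 2 * m
    l′ = solve-∀
    l : ∀ E x y z → (6 + 2 * E) * (x * (y * z)) ≡ x * y * ((6 + 2 * E) * z)
    l = solve-∀

theorem8p1 : (m : ℕ) (i j : Fin m) → i Fin.< j →
    ∃[ Q ] ∀ (q : ℕ) → Q ≤ q →
    (¬ (2 ∣ q) → + charQP m q (hPlus i j (+ 1)) ≡ oddFormula m q i j)
    × (2 ∣ q → + charQP m q (hPlus i j (+ 1)) ≡ evenFormula m q i j)
theorem8p1 m i j i<j = suc ((m + 2) * 2) , λ q Q≤q → odd q Q≤q , even q Q≤q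
  where
  -- Half of `q`, rounded down, is the number of levels; the threshold leaves at least two of them
  -- empty, the range in which the products are evaluated.
  excess-over : ∀ {k} → (m + 2) * 2 ≤ k * 2 → ∃ λ E → k ≡ m + 2 + E
  excess-over {k} le = k ∸ (m + 2) , sym (m+[n∸m]≡n (*-cancelʳ-≤ (m + 2) k 2 le))
  odd : ∀ q → suc ((m + 2) * 2) ≤ q → ¬ (2 ∣ q) → + charQP m q (hPlus i j (+ 1)) ≡ oddFormula m q i j
  odd q Q≤q 2∤q with even-or-odd q
  ... | k , inj₁ q≡ = contradiction (divides k q≡) 2∤q
  ... | k , inj₂ refl with excess-over {k} (≤-pred Q≤q)
  ...   | E , refl = Assembly.odd-case i<j E
  even : ∀ q → suc ((m + 2) * 2) ≤ q → 2 ∣ q → + charQP m q (hPlus i j (+ 1)) ≡ evenFormula m q i j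
  even q Q≤q (divides k refl) with excess-over {k} (<⇒≤ Q≤q)
  ... | E , refl = Assembly.even-case i<j E
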